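{- Let $\mathcal F_n$ be $\mathcal{BC}_n$ (types $B$ and $C$) or $\mathcal D_n$ (type $D$), and let $\mathfrak F$ denote $\mathfrak B$, $\mathfrak C$ or $\mathfrak D$ according to the type. If $w\in\mathcal F_n$ and $k\geq 0$, the $k$-truncation of the double Schubert polynomial of $w$ is the sum of monomials over all reduced double signed pipe dreams (of the same type, with $k$ $\Gamma$-blocks) of shape $w$: \[ \mathfrak F^{[k]}_w(\mathbf z,\mathbf x,\mathbf t)=\sum_{D \in \mathrm{DPD}^k_{\mathcal F_n}(w)}\mathbf x^{\alpha(D)}\mathbf z^{\beta(D)}(-\mathbf t)^{\beta'(D)}. \]
   Context: **Groups.** $\mathcal{BC}_n$ is the group of permutations $w$ of $\{\pm1,\dots,\pm n\}$ with $w(-i)=-w(i)$, generated by $s_0=(1\leftrightarrow -1)$ and $s_i=(i\leftrightarrow i+1)$ (also exchanging $-i,-(i+1)$), $1\le i\le n-1$. $\mathcal D_n\subset\mathcal{BC}_n$ (here $n\ge2$) consists of those $w$ with an even number of $i\in\{1,\dots,n\}$ with $w(i)<0$; its generators are $s_1,\dots,s_{n-1}$ and $s_{\hat1}=s_0s_1s_0$. Products are compositions of maps, $(uv)(i)=u(v(i))$. Length $\ell$ and reduced words are taken with respect to the generators of the group in question. $\mathcal{BC}_\infty$, $\mathcal D_\infty$ are the unions over $n$. **Double Schubert polynomials.** Let $\mathbb Q[\mathbf z,p_1(\mathbf x),p_3(\mathbf x),\dots,\mathbf t]$ be the polynomial ring in $z_1,z_2,\dots$, $t_1,t_2,\dots$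 and the odd power sums $p_k(\mathbf x)=\sum_i x_i^k$. Define ring automorphisms: $s^z_i$ ($i\ge1$) exchanges $z_i,z_{i+1}$; $s^z_0$: $z_1\mapsto-z_1$, $p_k(\mathbf x)\mapsto p_k(\mathbf x)+z_1^k$; $s^z_{\hat1}$: $z_1\mapsto-z_2$, $z_2\mapsto-z_1$, $p_k(\mathbf x)\mapsto p_k(\mathbf x)+z_1^k+z_2^k$; $s^t_i$ ($i\ge1$) exchanges $t_i,t_{i+1}$; $s_0^t$: $t_1\mapsto-t_1$, $p_k(\mathbf x)\mapsto p_k(\mathbf x)+(-t_1)^k$; $s^t_{\hat1}$: $t_1\mapsto-t_2$, $t_2\mapsto-t_1$, $p_k(\mathbf x)\mapsto p_k(\mathbf x)+(-t_1)^k+(-t_2)^k$ (all other generators fixed). Put $\partial_i f=\frac{f-s_i^zf}{z_i-z_{i+1}}$, $\delta_if=\frac{f-s_i^tf}{t_{i+1}-t_i}$ for $i\ge1$; $\partial_0f=\frac{f-s^z_0f}{ -2z_1}$, $\delta_0f=\frac{f-s_0^tf}{2t_1}$; $\partial_0^B=2\partial_0$, $\delta_0^B=2\delta_0$; $\partial_{\hat1}f=\frac{f-s^z_{\hat1}f}{ -z_1-z_2}$, $\delta_{\hat1}f=\frac{f-s^t_{\hat1}f}{t_1+t_2}$. The double Schubert polynomials $\mathfrak B_w,\mathfrak C_w$ ($w\in\mathcal{BC}_\infty$), $\mathfrak D_w$ ($w\in\mathcal D_\infty$) are the unique families $\mathfrak F_w(\mathbf z,\mathbf x,\mathbf t)$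 in this ring with $\mathfrak F_{\mathrm{id}}=1$, zero constant term for $w\ne\mathrm{id}$, and, for each index $i$ of a generator of the group, $\partial_i\mathfrak F_w=\mathfrak F_{ws_i}$ if $\ell(ws_i)<\ell(w)$ and $0$ otherwise, and $\delta_i\mathfrak F_w=\mathfrak F_{s_iw}$ if $\ell(s_iw)<\ell(w)$ and $0$ otherwise; here $i\in\{0,1,2,\dots\}$ for type $C$; the same for type $B$ but with $\partial_0^B,\delta_0^B$ in place of $\partial_0,\delta_0$; and $i\in\{\hat1,1,2,\dots\}$ for type $D$ (existence and uniqueness are due to Ikeda, Mihalcea and Naruse). The $k$-truncation is $\mathfrak F^{[k]}_w(\mathbf z,\mathbf x,\mathbf t)=\mathfrak F_w(\mathbf z;x_1,\dots,x_k,0,0,\dots;\mathbf t)$. **Double signed pipe dreams.** The base $DB^k_{\mathcal F_n}$ consists, from bottom to top, of a lower staircase block, $k$ $\Gamma$-blocks numbered $1,\dots,k$ from bottom to top, and an upper staircase block. Each staircase block has boxes $(i,j)$, $1\le i\le n-1$, $1\le j\le n-i$ (row $i$ from the top, column $j$ from the left), and the box $(i,j)$ is indexed by $i+j-1$; its variable is $z_i$ in the lower staircase block and $-t_j$ in the upper one. All boxes of the $m$-th $\Gamma$-block have variable $x_m$. The $\Gamma$-blocks are as follows. - Type $C$: a horizontal row of $n$ boxes indexed $0,\dots,n-1$ from left to right and, below it, a vertical column of $n$ boxes indexed $0,\dots,n-1$ from top to bottom. - Type $B$: a corner box indexed $0$, boxes $1,\dots,n-1$ to the right of the corner in its row (left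 to right), and boxes $1,\dots,n-1$ below the corner in its column (top to bottom). - Type $D$: a corner box indexed $1'$, boxes $2,\dots,n-1$ to the right of the corner in its row (left to right), and boxes $2,\dots,n-1$ below the corner in its column (top to bottom). A double signed pipe dream is a filling of the boxes. Each box indexed by $0$ contains an elbow (weight $0$, no letter) or an elbow with a faucet (weight $1$, letter $s_0$). Each box indexed by $1'$ contains an elbow (weight $0$, no letter), a cross (weight $1$, letter $s_1$), a cross with a faucet (weight $1$, letter $s_{\hat1}$), or an elbow with two faucets (weight $2$, the two commuting letters $s_1,s_{\hat1}$). Each other box, of index $i$, contains an elbow (weight $0$, no letter) or a cross (weight $1$, letter $s_i$). The word of $D$ is obtained by reading the letters from top to bottom and in each row from right to left: the upper staircase rows $1,\dots,n-1$, each from right to left; then the $\Gamma$-blocks $k,\dots,1$, each one by reading its horizontal boxes from right to left (in types $B$, $D$ ending with the corner) and then its vertical boxes from top to bottom; then the lower staircase rows $1,\dots,n-1$, each from right to left. (In type $D$ the two letters of an elbow with two faucets may be read in either order.) $D$ is reduced of shape $w$ if its word is a reduced word of $w\in\mathcal F_n$; $\mathrm{DPD}^k_{\mathcal F_n}(w)$ is the set of all such $D$. $\mathbf x^{\alpha(D)}\mathbf z^{\beta(D)}(-\mathbf t)^{\beta'(D)}$ is the product over all boxes of the variable of the box raised to the weight of its element. -}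

module Defs where

open import Algebra.Bundles using (CommutativeRing)
import Algebra.Properties.Semiring.Exp as Exp
open import Data.Fin.Base using (Fin)
open import Data.List.Base
  using (List; []; _∷_; [_]; _++_; map; concatMap; foldr; filter; length;
         reverse; upTo; downFrom; allFin)
open import Data.List.Membership.Propositional using (_∈_)
open import Data.List.Relation.Unary.All using (All; []; _∷_)
open import Data.List.Relation.Unary.Unique.Propositional using (Unique)
open import Data.Nat.Base as ℕ using (ℕ; zero; suc; _∸_; _≤_; _<_)
open import Data.Nat.Divisibility using (_∣_)
open import Data.Product.Base using (Σ-syntax; ∃-syntax; _×_; _,_; proj₁)
open import Data.Rational.Base as ℚ using (ℚ; 0ℚ; 1ℚ)
open import Data.Sign.Base as Sign using (Sign; opposite)
import Data.Sign.Properties as Sign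
open import Data.Unit.Base using (⊤)
open import Function.Base using (id; _∘_)
open import Function.Bundles using (_↔_; _⇔_; module Inverse)
open import Level using (0ℓ)
open import Relation.Binary.PropositionalEquality.Core using (_≡_; _≗_)
open import Relation.Nullary.Negation.Core using (¬_)
open import Relation.Unary using (Pred; U)

-- ℚ[V] is the free commutative ℚ-algebra on V: terms modulo the congruence
-- _≈_ generated by the commutative ring laws and by con : ℚ → ℚ[V] being a
-- ring homomorphism.

infixl 6 _+_ _-_
infixl 7 _*_
infix  8 -_
infixr 9 _^_
infix  4 _≈_

data Poly (V : Set) : Set where
  con     : ℚ → Poly V
  var     : V → Poly V
  _+_ _*_ : Poly V → Poly V → Poly V
  -_      : Poly V → Poly V

data _≈_ {V : Set} : Poly V → Poly V → Set where
  ≈-refl   : ∀ {f} → f ≈ f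
  ≈-sym    : ∀ {f g} → f ≈ g → g ≈ f
  ≈-trans  : ∀ {f g h} → f ≈ g → g ≈ h → f ≈ h
  +-cong   : ∀ {f f′ g g′} → f ≈ f′ → g ≈ g′ → f + g ≈ f′ + g′
  *-cong   : ∀ {f f′ g g′} → f ≈ f′ → g ≈ g′ → f * g ≈ f′ * g′
  -‿cong   : ∀ {f f′} → f ≈ f′ → - f ≈ - f′
  +-assoc  : ∀ f g h → (f + g) + h ≈ f + (g + h)
  +-comm   : ∀ f g → f + g ≈ g + f
  +-idˡ    : ∀ f → con 0ℚ + f ≈ f
  -‿invˡ   : ∀ f → - f + f ≈ con 0ℚ
  *-assoc  : ∀ f g h → (f * g) * h ≈ f * (g * h)
  *-comm   : ∀ f g → f * g ≈ g * f
  *-idˡ    : ∀ f → con 1ℚ * f ≈ f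
  distribʳ : ∀ f g h → (g + h) * f ≈ g * f + h * f
  con-+    : ∀ a b → con (a ℚ.+ b) ≈ con a + con b
  con-*    : ∀ a b → con (a ℚ.* b) ≈ con a * con b

polyRing : Set → CommutativeRing 0ℓ 0ℓ
polyRing V = record
  { Carrier = Poly V ; _≈_ = _≈_ ; _+_ = _+_ ; _*_ = _*_ ; -_ = -_
  ; 0# = con 0ℚ ; 1# = con 1ℚ
  ; isCommutativeRing = record
    { isRing = record
      { +-isAbelianGroup = record
        { isGroup = record
          { isMonoid = record
            { isSemigroup = record
              { isMagma = record
                { isEquivalence = record
                  { refl = ≈-refl ; sym = ≈-sym ; trans = ≈-trans }
                ; ∙-cong = +-cong }
              ; assoc = +-assoc }
            ; identity = +-idˡ , λ f → ≈-trans (+-comm f _) (+-idˡ f) }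
          ; inverse = -‿invˡ , λ f → ≈-trans (+-comm f _) (-‿invˡ f)
          ; ⁻¹-cong = -‿cong }
        ; comm = +-comm }
      ; *-cong = *-cong
      ; *-assoc = *-assoc
      ; *-identity = *-idˡ , λ f → ≈-trans (*-comm f _) (*-idˡ f)
      ; distrib = (λ f g h → ≈-trans (*-comm f _) (≈-trans (distribʳ f g h)
                    (+-cong (*-comm g f) (*-comm h f))))
                , distribʳ }
    ; *-comm = *-comm }
  }

_-_ : ∀ {V} → Poly V → Poly V → Poly V
f - g = f + (- g)

_^_ : ∀ {V} → Poly V → ℕ → Poly V
_^_ {V} = Exp._^_ (CommutativeRing.semiring (polyRing V))

2# : ∀ {V} → Poly V
2# = con (1ℚ ℚ.+ 1ℚ)

∑ : ∀ {A V : Set} → List A → (A → Poly V) → Poly V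
∑ as f = foldr (λ a g → f a + g) (con 0ℚ) as

subst : ∀ {V W} → (V → Poly W) → Poly V → Poly W
subst σ (con a) = con a
subst σ (var v) = σ v
subst σ (f + g) = subst σ f + subst σ g
subst σ (f * g) = subst σ f * subst σ g
subst σ (- f)   = - subst σ f

constantTerm : ∀ {V} → Poly V → ℚ
constantTerm (con a) = a
constantTerm (var v) = 0ℚ
constantTerm (f + g) = constantTerm f ℚ.+ constantTerm g
constantTerm (f * g) = constantTerm f ℚ.* constantTerm g
constantTerm (- f)   = ℚ.- constantTerm f

data LieType : Set where
  B C D : LieType

-- (ε , i) stands for the nonzero integer ε(i+1).
Signed : Set
Signed = Sign × ℕ

neg : Signed → Signed
neg (ε , i) = opposite ε , i

-- Permutations of {±1,±2,…} commuting with negation.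
record SignedPerm : Set where
  field
    perm : Signed ↔ Signed
    odd  : ∀ a → Inverse.to perm (neg a) ≡ neg (Inverse.to perm a)

  to : Signed → Signed
  to = Inverse.to perm

open SignedPerm using (to)

minRank : LieType → ℕ
minRank B = 1
minRank C = 1
minRank D = 2

-- Membership in BCₙ, a permutation of {±1,…,±n} being extended by the identity.
InBC : ℕ → SignedPerm → Set
InBC n w = ∀ ε i → n ≤ i → to w (ε , i) ≡ (ε , i)

negatives : ℕ → SignedPerm → ℕ
negatives n w = length (filter (λ i → proj₁ (to w (Sign.+ , i)) Sign.≟ Sign.-) (upTo n))

InGroup : LieType → ℕ → SignedPerm → Set
InGroup B n w = InBC n w
InGroup C n w = InBC n w
InGroup D n w = InBC n w × 2 ∣ negatives n w

-- The union of the groups; equality of elements is equality of maps.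
record Group∞ (X : LieType) : Set where
  field
    signedPerm : SignedPerm
    bounded    : ∃[ n ] minRank X ≤ n × InGroup X n signedPerm

  ⟪_⟫ : Signed → Signed
  ⟪_⟫ = to signedPerm

open Group∞ using (signedPerm; ⟪_⟫) public

-- s̃ is s₀ in types B and C and s_1̂ in type D; s i is s_{i+1}.
data Gen : Set where
  s̃ : Gen
  s : ℕ → Gen

swap : ℕ → ℕ → ℕ
swap zero    zero          = 1
swap zero    (suc zero)    = 0
swap zero    (suc (suc j)) = suc (suc j)
swap (suc i) zero          = zero
swap (suc i) (suc j)       = suc (swap i j)

s₀ : Signed → Signed
s₀ (ε , zero)  = opposite ε , zero
s₀ (ε , suc i) = ε , suc i

s₊ : ℕ → Signed → Signed
s₊ i (ε , j) = ε , swap i j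

gen : LieType → Gen → Signed → Signed
gen X (s i) = s₊ i
gen B s̃ = s₀
gen C s̃ = s₀
gen D s̃ = s₀ ∘ s₊ 0 ∘ s₀

GenOfRank : ℕ → Pred Gen 0ℓ
GenOfRank n s̃     = ⊤
GenOfRank n (s i) = suc i < n

∏ : LieType → List Gen → Signed → Signed
∏ X = foldr (λ g f → gen X g ∘ f) id

-- Reducedness in the group with generating set G.
record IsReducedWord (X : LieType) (G : Pred Gen 0ℓ)
                     (as : List Gen) (f : Signed → Signed) : Set where
  field
    letters  : All G as
    product  : ∏ X as ≗ f
    shortest : ∀ bs → All G bs → ∏ X bs ≗ f → length as ≤ length bs

-- ℓ(f) < ℓ(h) in the infinite group, ℓ being the length of a reduced word.
Shorter : LieType → (f h : Signed → Signed) → Set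
Shorter X f h = ∃[ as ] ∃[ bs ]
  IsReducedWord X U as f × IsReducedWord X U bs h × length as < length bs

-- z i is z_{i+1}, t i is t_{i+1}, p j is the power sum p_{2j+1}(x).
data Var : Set where
  z t p : ℕ → Var

𝓡 : Set
𝓡 = Poly Var

odd# : ℕ → ℕ
odd# j = suc (2 ℕ.* j)

s₀ᶻ s₁̂ᶻ s₀ᵗ s₁̂ᵗ : Var → 𝓡

s₀ᶻ (z zero) = - var (z 0)
s₀ᶻ (p j)    = var (p j) + var (z 0) ^ odd# j
s₀ᶻ v        = var v

s₁̂ᶻ (z zero)       = - var (z 1)
s₁̂ᶻ (z (suc zero)) = - var (z 0)
s₁̂ᶻ (p j)          = var (p j) + var (z 0) ^ odd# j + var (z 1) ^ odd# j
s₁̂ᶻ v              = var v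

s₀ᵗ (t zero) = - var (t 0)
s₀ᵗ (p j)    = var (p j) + (- var (t 0)) ^ odd# j
s₀ᵗ v        = var v

s₁̂ᵗ (t zero)       = - var (t 1)
s₁̂ᵗ (t (suc zero)) = - var (t 0)
s₁̂ᵗ (p j)          = var (p j) + (- var (t 0)) ^ odd# j + (- var (t 1)) ^ odd# j
s₁̂ᵗ v              = var v

swapᶻ swapᵗ : ℕ → Var → 𝓡

swapᶻ i (z j) = var (z (swap i j))
swapᶻ i v     = var v

swapᵗ i (t j) = var (t (swap i j))
swapᵗ i v     = var v

actᶻ actᵗ : LieType → Gen → 𝓡 → 𝓡

actᶻ X (s i) = subst (swapᶻ i)
actᶻ B s̃ = subst s₀ᶻ
actᶻ C s̃ = subst s₀ᶻ
actᶻ D s̃ = subst s₁̂ᶻ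

actᵗ X (s i) = subst (swapᵗ i)
actᵗ B s̃ = subst s₀ᵗ
actᵗ C s̃ = subst s₀ᵗ
actᵗ D s̃ = subst s₁̂ᵗ

denᶻ denᵗ : LieType → Gen → 𝓡

denᶻ X (s i) = var (z i) - var (z (suc i))
denᶻ B s̃ = - (2# * var (z 0))
denᶻ C s̃ = - (2# * var (z 0))
denᶻ D s̃ = - var (z 0) - var (z 1)

denᵗ X (s i) = var (t (suc i)) - var (t i)
denᵗ B s̃ = 2# * var (t 0)
denᵗ C s̃ = 2# * var (t 0)
denᵗ D s̃ = var (t 0) + var (t 1)

-- The factor 2 in ∂₀ᴮ = 2∂₀ and δ₀ᴮ = 2δ₀.
scale : LieType → Gen → 𝓡
scale B s̃     = 2#
scale C s̃     = con 1ℚ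
scale D s̃     = con 1ℚ
scale X (s i) = con 1ℚ

-- ∂[ X , g ] f ≐ h says that h is the quotient scale · (f − s_g f) / den.
-- It is unique, since the ring is an integral domain and den is nonzero.
∂[_,_]_≐_ δ[_,_]_≐_ : LieType → Gen → 𝓡 → 𝓡 → Set
∂[ X , g ] f ≐ h = denᶻ X g * h ≈ scale X g * (f - actᶻ X g f)
δ[ X , g ] f ≐ h = denᵗ X g * h ≈ scale X g * (f - actᵗ X g f)

record IsDoubleSchubert (X : LieType) (𝔉 : Group∞ X → 𝓡) : Set where
  field
    respects : ∀ v w → ⟪ v ⟫ ≗ ⟪ w ⟫ → 𝔉 v ≈ 𝔉 w
    identity : ∀ w → ⟪ w ⟫ ≗ id → 𝔉 w ≈ con 1ℚ
    constant : ∀ w → ¬ (⟪ w ⟫ ≗ id) → constantTerm (𝔉 w) ≡ 0ℚ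
    -- In ∂-desc and δ-desc, v is w s_g and s_g w respectively.
    ∂-desc   : ∀ g w v → ⟪ v ⟫ ≗ ⟪ w ⟫ ∘ gen X g →
               Shorter X ⟪ v ⟫ ⟪ w ⟫ → ∂[ X , g ] 𝔉 w ≐ 𝔉 v
    ∂-asc    : ∀ g w → ¬ Shorter X (⟪ w ⟫ ∘ gen X g) ⟪ w ⟫ →
               ∂[ X , g ] 𝔉 w ≐ con 0ℚ
    δ-desc   : ∀ g w v → ⟪ v ⟫ ≗ gen X g ∘ ⟪ w ⟫ →
               Shorter X ⟪ v ⟫ ⟪ w ⟫ → δ[ X , g ] 𝔉 w ≐ 𝔉 v
    δ-asc    : ∀ g w → ¬ Shorter X (gen X g ∘ ⟪ w ⟫) ⟪ w ⟫ →
               δ[ X , g ] 𝔉 w ≐ con 0ℚ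

data TruncVar (k : ℕ) : Set where
  z t : ℕ → TruncVar k
  x   : Fin k → TruncVar k

truncate : ∀ k → 𝓡 → Poly (TruncVar k)
truncate k = subst λ where
  (z i) → var (z i)
  (t i) → var (t i)
  (p j) → ∑ (allFin k) λ m → var (x m) ^ odd# j

-- # i is the box index i+1.
data Index : Set where
  0′ 1′ : Index
  #_    : ℕ → Index

record Box (k : ℕ) : Set where
  constructor box
  field
    index     : Index
    variable′ : Poly (TruncVar k)

open Box

data Tile : Index → Set where
  elbow        : ∀ {ι} → Tile ι
  elbowFaucet  : Tile 0′
  cross′       : Tile 1′
  crossFaucet  : Tile 1′
  elbowFaucets : Tile 1′
  cross        : ∀ {i} → Tile (# i)

-- s₁ and s_1̂ commute, so the order chosen for elbowFaucets is immaterial.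
letters : ∀ {ι} → Tile ι → List Gen
letters elbow        = []
letters elbowFaucet  = [ s̃ ]
letters cross′       = [ s 0 ]
letters crossFaucet  = [ s̃ ]
letters elbowFaucets = s 0 ∷ s̃ ∷ []
letters (cross {i})  = [ s i ]

weight : ∀ {ι} → Tile ι → ℕ
weight elbow        = 0
weight elbowFaucet  = 1
weight cross′       = 1
weight crossFaucet  = 1
weight elbowFaucets = 2
weight cross        = 1

-- A base is recorded as the list of its boxes in reading order.  Below, i and
-- j are the row and the column of a box, counted from 0.
staircase : ∀ {k} → ℕ → (ℕ → ℕ → Poly (TruncVar k)) → List (Box k)
staircase n f =
  concatMap (λ i → map (λ j → box (# (i ℕ.+ j)) (f i j)) (downFrom (n ∸ suc i)))
            (upTo (n ∸ 1))

Γ-indices : LieType → ℕ → List Index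
Γ-indices C n = map index₀ (downFrom n) ++ map index₀ (upTo n)
  where
  index₀ : ℕ → Index
  index₀ zero    = 0′
  index₀ (suc i) = # i
Γ-indices B n = map #_ (downFrom (n ∸ 1)) ++ 0′ ∷ map #_ (upTo (n ∸ 1))
Γ-indices D n = map (#_ ∘ suc) (downFrom (n ∸ 2)) ++ 1′ ∷ map (#_ ∘ suc) (upTo (n ∸ 2))

base : LieType → ∀ n k → List (Box k)
base X n k =
  staircase n (λ i j → - var (t j)) ++
  concatMap (λ m → map (λ ι → box ι (var (x m))) (Γ-indices X n)) (reverse (allFin k)) ++
  staircase n (λ i j → var (z i))

Filling : ∀ {k} → List (Box k) → Set
Filling = All (Tile ∘ index)

word : ∀ {k} {bs : List (Box k)} → Filling bs → List Gen
word []      = []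
word (a ∷ T) = letters a ++ word T

monomial : ∀ {k} {bs : List (Box k)} → Filling bs → Poly (TruncVar k)
monomial []            = con 1ℚ
monomial (_∷_ {b} a T) = variable′ b ^ weight a * monomial T

PipeDream : LieType → ℕ → ℕ → Set
PipeDream X n k = Filling (base X n k)

DPD : ∀ X n k → Group∞ X → Pred (PipeDream X n k) 0ℓ
DPD X n k w T = IsReducedWord X (GenOfRank n) (word T) ⟪ w ⟫

Enumerates : ∀ {A : Set} → List A → Pred A 0ℓ → Set
Enumerates as P = Unique as × (∀ a → a ∈ as ⇔ P a)

{-# OPTIONS --safe #-}

-- Collect the polynomials of F_n into 𝔉 = Σ_w 𝔉_w u_w over the nilCoxeter
-- algebra and put h_g(c) = 1 + c u_g.  The recurrences say that every
-- generator acts on the variables by multiplication: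
--   s_i^z 𝔉 = 𝔉 h_i(z_{i+1} − z_i),  s_i^t 𝔉 = h_i(t_i − t_{i+1}) 𝔉,
--   s_0^z 𝔉 = 𝔉 h_0(2z_1) (type C) or 𝔉 h_0(z_1) (type B),
--   s_1̂^z 𝔉 = 𝔉 h_1̂(z_1 + z_2) (type D).
-- Moreover s_i acts trivially for i ≥ n, so an entry inserted into z or t at
-- position ≥ n may be pushed to infinity, where it has no effect.  Moving an
-- entry z_i from position n through zeros to position i produces the i-th row
-- of the lower staircase block; moving a zero through the t-variables produces
-- a row of the upper one.  Since s_0^z adds z_1 to the x-variables and changes
-- the sign of z_1, moving y = x_m from position n to 1, applying s_0^z, and
-- moving −y back yields a Γ-block: its boxes are exactly these factors.  What
-- remains is 𝔉 at the origin, that is, its constant term 1.  (In type D the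
-- same works with s_1̂ acting on (y, 0), since 0 contributes nothing to the
-- odd power sums.)

module Submission where

open import Defs
open import Algebra.Bundles using (CommutativeRing)
import Algebra.Properties.Ring as RingProperties
import Algebra.Solver.Ring.NaturalCoefficients.Default as Solver
open import Data.Bool.Base using (Bool; true; false; if_then_else_)
open import Data.Empty using (⊥; ⊥-elim)
open import Data.List.Base
  using (List; []; _∷_; [_]; _++_; _∷ʳ_; _ʳ++_; length; map; concat; concatMap; filter; reverse;
         upTo; downFrom; applyUpTo; applyDownFrom; allFin; cartesianProductWith)
open import Data.List.Membership.Propositional using (_∈_)
open import Data.List.Membership.Propositional.Properties
  using (∈-cartesianProductWith⁺; ∈-filter⁺; ∈-filter⁻)
import Data.List.Properties as List
open import Data.List.Relation.Unary.All as All using (All; []; _∷_)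
import Data.List.Relation.Unary.All.Properties as All
open import Data.List.Relation.Unary.AllPairs using ([]; _∷_)
open import Data.List.Relation.Unary.Any using (here; there)
open import Data.List.Relation.Unary.Unique.Propositional using (Unique)
import Data.List.Relation.Unary.Unique.Propositional.Properties as Unique
open import Data.Nat.Base as ℕ
  using (ℕ; zero; suc; _≤_; _<_; z≤n; s≤s; _≤′_; ≤′-step; ≤′-refl; _⊔_; _∸_)
open import Data.Nat.Divisibility as ∣ using (_∣_)
open import Data.Nat.Induction using (<-wellFounded)
import Data.Nat.Properties as ℕ
open import Algebra.Properties.CommutativeSemigroup ℕ.+-commutativeSemigroup using (xy∙z≈xz∙y)
open import Data.Nat.Solver using (module +-*-Solver)
open import Data.Product.Base using (Σ-syntax; ∃-syntax; _×_; _,_; proj₁; proj₂)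
open import Data.Rational.Base as ℚ using (0ℚ; 1ℚ; ½)
import Data.Rational.Properties as ℚ
import Data.Sign.Base as Sign
import Data.Sign.Properties as Sign
open import Data.Sum.Base using (_⊎_; inj₁; inj₂)
open import Data.Unit.Base using (⊤; tt)
open import Function.Base using (id; _∘_)
open import Function.Bundles using (mk⇔; mk↔ₛ′; module Inverse)
open import Induction.WellFounded using (Acc; acc)
open import Level using (0ℓ)
open import Relation.Binary.Definitions using (tri<; tri≈; tri>)
open import Relation.Binary.PropositionalEquality.Core as ≡
  using (_≡_; _≢_; _≗_; refl; sym; trans; cong; cong₂)
open import Relation.Binary.PropositionalEquality.Properties using (module ≡-Reasoning)
import Relation.Binary.Reasoning.Setoid as SetoidReasoning
open import Relation.Nullary.Decidable
  using (Dec; yes; no; does; does-⇔; dec-true; dec-false; map′; _×-dec_)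
open import Relation.Nullary.Negation.Core using (¬_; contradiction)
open import Relation.Unary using (Pred; Decidable)

-- The recurrences compare lengths in the infinite group, whereas a pipe dream spells a reduced word
-- in rank `n`. Both lengths are tied to one explicit number, the inversion count `inv X n f`: it
-- bounds every word for `f` from below, even a word with letters outside rank `n`, and it is
-- attained by a word inside rank `n`. This makes reducedness decidable and shows that multiplying
-- by a generator outside rank `n` never shortens an element, which is why such generators fix 𝔉_w.
--
-- The nilCoxeter algebra appears only through coefficients. A family `E : 𝔽 → Poly V` stands for
-- Σ_w E(w) u_w, and multiplication by 1 + c u_g becomes `actʳ` or `actˡ`, defined by a test for a
-- descent. A list of boxes `Represents` the family to which the product of its factors expands, so
-- the base can be built from the empty list by adding boxes at either end. The polynomials 𝔉_w are
-- evaluated at points (ζ, τ, xs), and each automorphism becomes a change of the point.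

swap-below : ∀ {i j} → j < i → swap i j ≡ j
swap-below {suc i} {zero}  _         = refl
swap-below {suc i} {suc j} (s≤s j<i) = cong suc (swap-below j<i)

swap-above : ∀ {i j} → suc i < j → swap i j ≡ j
swap-above {zero}  {suc (suc j)} _         = refl
swap-above {zero}  {suc zero} (s≤s ())
swap-above {suc i} {suc j}       (s≤s i<j) = cong suc (swap-above i<j)

swap-left : ∀ i → swap i i ≡ suc i
swap-left zero    = refl
swap-left (suc i) = cong suc (swap-left i)

swap-right : ∀ i → swap i (suc i) ≡ i
swap-right zero    = refl
swap-right (suc i) = cong suc (swap-right i)

swap-involutive : ∀ i j → swap i (swap i j) ≡ j
swap-involutive zero    zero          = refl
swap-involutive zero    (suc zero)    = refl
swap-involutive zero    (suc (suc j)) = refl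
swap-involutive (suc i) zero          = refl
swap-involutive (suc i) (suc j)       = cong suc (swap-involutive i j)

Σ< : ℕ → (ℕ → ℕ) → ℕ
Σ< zero    u = 0
Σ< (suc N) u = Σ< N u ℕ.+ u N

Σ<-cong : ∀ N {u v} → (∀ {j} → j < N → u j ≡ v j) → Σ< N u ≡ Σ< N v
Σ<-cong zero    eq = refl
Σ<-cong (suc N) eq = cong₂ ℕ._+_ (Σ<-cong N (eq ∘ ℕ.m<n⇒m<1+n)) (eq (ℕ.n<1+n N))

-- With `≤′` the induction starts at `N = 2 + i`, where the exchanged terms are the last two.
Σ<-swap : ∀ u {i N} → 2 ℕ.+ i ≤′ N → Σ< N (u ∘ swap i) ≡ Σ< N u
Σ<-swap u {i} ≤′-refl
  rewrite swap-left i | swap-right i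
        | Σ<-cong i {u ∘ swap i} {u} (cong u ∘ swap-below) =
  solve 3 (λ a b c → a :+ b :+ c := a :+ c :+ b) refl (Σ< i u) (u (suc i)) (u i)
  where open +-*-Solver
Σ<-swap u (≤′-step i<N) =
  cong₂ ℕ._+_ (Σ<-swap u i<N) (cong u (swap-above (ℕ.≤′⇒≤ i<N)))

-- Length in the groups BCₙ and Dₙ

s₀-involutive : ∀ a → s₀ (s₀ a) ≡ a
s₀-involutive (ε , zero)  = cong (_, 0) (Sign.opposite-selfInverse {ε} refl)
s₀-involutive (ε , suc i) = refl

s₊-involutive : ∀ i a → s₊ i (s₊ i a) ≡ a
s₊-involutive i (ε , j) = cong (ε ,_) (swap-involutive i j)

s₀ₛ-involutive : ∀ a → gen D s̃ (gen D s̃ a) ≡ a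
s₀ₛ-involutive a = trans (cong (s₀ ∘ s₊ 0) (s₀-involutive _))
  (trans (cong s₀ (s₊-involutive 0 _)) (s₀-involutive a))

gen-involutive : ∀ X g a → gen X g (gen X g a) ≡ a
gen-involutive X (s i) a = s₊-involutive i a
gen-involutive B s̃ a = s₀-involutive a
gen-involutive C s̃ a = s₀-involutive a
gen-involutive D s̃ a = s₀ₛ-involutive a

s₀-odd : ∀ a → s₀ (neg a) ≡ neg (s₀ a)
s₀-odd (ε , zero)  = refl
s₀-odd (ε , suc i) = refl

gen-odd : ∀ X g a → gen X g (neg a) ≡ neg (gen X g a)
gen-odd X (s i) a = refl
gen-odd B s̃ a = s₀-odd a
gen-odd C s̃ a = s₀-odd a
gen-odd D s̃ a = trans (cong (s₀ ∘ s₊ 0) (s₀-odd a)) (s₀-odd (s₊ 0 (s₀ a)))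

gen-fixed : ∀ X {n} → minRank X ≤ n → ∀ g → GenOfRank n g →
            ∀ ε i → n ≤ i → gen X g (ε , i) ≡ (ε , i)
gen-fixed X _ (s i) i<n ε j n≤j = cong (ε ,_) (swap-above (ℕ.≤-trans i<n n≤j))
gen-fixed B (s≤s _) s̃ _ ε (suc i) _ = refl
gen-fixed C (s≤s _) s̃ _ ε (suc i) _ = refl
gen-fixed D (s≤s (s≤s _)) s̃ _ ε (suc zero) (s≤s ())
gen-fixed D (s≤s (s≤s _)) s̃ _ ε (suc (suc i)) _ = refl

sameRank : ∀ a b → proj₂ a ≡ proj₂ b → a ≡ b ⊎ a ≡ neg b
sameRank (Sign.+ , i) (Sign.+ , .i) refl = inj₁ refl
sameRank (Sign.+ , i) (Sign.- , .i) refl = inj₂ refl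
sameRank (Sign.- , i) (Sign.+ , .i) refl = inj₂ refl
sameRank (Sign.- , i) (Sign.- , .i) refl = inj₁ refl

isNeg : Signed → ℕ
isNeg (Sign.+ , _) = 0
isNeg (Sign.- , _) = 1

long : LieType → Signed → ℕ
long B = isNeg
long C = isNeg
long D _ = 0

-- [a > b] + [a + b < 0] for |a| ≠ |b|; the values for |a| = |b| are junk.
κ : Signed → Signed → ℕ
κ (_ , i) (η , j) = if does (i ℕ.<? j) then 2 ℕ.* isNeg (η , j) else 1

κ-< : ∀ {i j ε η} → i < j → κ (ε , i) (η , j) ≡ 2 ℕ.* isNeg (η , j)
κ-< {i} {j} i<j rewrite dec-true (i ℕ.<? j) i<j = refl

κ-≮ : ∀ {i j ε η} → ¬ i < j → κ (ε , i) (η , j) ≡ 1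
κ-≮ {i} {j} i≮j rewrite dec-false (i ℕ.<? j) i≮j = refl

infix 25 _⁺_
_⁺_ : (Signed → Signed) → ℕ → Signed
f ⁺ i = f (Sign.+ , i)

-- The number of positive roots made negative by f, which is the length of f
-- if f fixes the i ≥ N.
inv : LieType → ℕ → (Signed → Signed) → ℕ
inv X N f = Σ< N λ j → long X (f ⁺ j) ℕ.+ Σ< j λ i → κ (f ⁺ i) (f ⁺ j)

negs : ℕ → (Signed → Signed) → ℕ
negs N f = Σ< N λ i → isNeg (f ⁺ i)

inv-cong : ∀ X N {f g} → f ≗ g → inv X N f ≡ inv X N g
inv-cong X N eq = Σ<-cong N λ {j} _ →
  cong₂ ℕ._+_ (cong (long X) (eq _)) (Σ<-cong j λ _ → cong₂ κ (eq _) (eq _))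

negs-cong : ∀ N {f g} → f ≗ g → negs N f ≡ negs N g
negs-cong N eq = Σ<-cong N λ _ → cong isNeg (eq _)

-- The reflection s_i permutes the positive roots other than the one it negates, so only the pair of
-- positions `i`, `i + 1` matters. The equation is additive to avoid subtraction; the symmetric
-- summand [a + b < 0] of `κ` occurs on both sides.
inv-s₊ : ∀ X f {i N} → 2 ℕ.+ i ≤′ N →
  inv X N (f ∘ s₊ i) ℕ.+ κ (f ⁺ i) (f ⁺ suc i) ≡ inv X N f ℕ.+ κ (f ⁺ suc i) (f ⁺ i)
inv-s₊ X f {i} ≤′-refl
  rewrite swap-left i | swap-right i
        | Σ<-cong i {λ j → long X (f ⁺ swap i j) ℕ.+ Σ< j λ k → κ (f ⁺ swap i k) (f ⁺ swap i j)}
            {λ j → long X (f ⁺ j) ℕ.+ Σ< j λ k → κ (f ⁺ k) (f ⁺ j)}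
            (λ {j} j<i → cong₂ ℕ._+_ (cong (λ l → long X (f ⁺ l)) (swap-below j<i))
               (Σ<-cong j λ k<j → cong₂ κ (cong (f ⁺_) (swap-below (ℕ.<-trans k<j j<i)))
                                          (cong (f ⁺_) (swap-below j<i))))
        | Σ<-cong i {λ k → κ (f ⁺ swap i k) (f ⁺ i)} {λ k → κ (f ⁺ k) (f ⁺ i)}
            (λ k<i → cong (λ l → κ (f ⁺ l) (f ⁺ i)) (swap-below k<i))
        | Σ<-cong i {λ k → κ (f ⁺ swap i k) (f ⁺ suc i)} {λ k → κ (f ⁺ k) (f ⁺ suc i)}
            (λ k<i → cong (λ l → κ (f ⁺ l) (f ⁺ suc i)) (swap-below k<i)) =
  solve 7 (λ a b c d e u v → a :+ (b :+ c) :+ (d :+ (e :+ u)) :+ v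
                          := a :+ (d :+ e) :+ (b :+ (c :+ v)) :+ u) refl
    (inv X i f) (long X (f ⁺ suc i)) (Σ< i λ k → κ (f ⁺ k) (f ⁺ suc i))
    (long X (f ⁺ i)) (Σ< i λ k → κ (f ⁺ k) (f ⁺ i))
    (κ (f ⁺ suc i) (f ⁺ i)) (κ (f ⁺ i) (f ⁺ suc i))
  where open +-*-Solver
inv-s₊ X f {i} {suc N} (≤′-step i<N)
  rewrite swap-above {i} (ℕ.≤′⇒≤ i<N) | Σ<-swap (λ k → κ (f ⁺ k) (f ⁺ N)) i<N = begin
  a′ ℕ.+ c ℕ.+ u    ≡⟨ xy∙z≈xz∙y a′ c u ⟩
  a′ ℕ.+ u ℕ.+ c    ≡⟨ cong (ℕ._+ c) (inv-s₊ X f i<N) ⟩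
  a ℕ.+ u′ ℕ.+ c    ≡⟨ xy∙z≈xz∙y a u′ c ⟩
  a ℕ.+ c ℕ.+ u′    ∎
  where
  open ≡-Reasoning
  a = inv X N f
  a′ = inv X N (f ∘ s₊ i)
  c = long X (f ⁺ N) ℕ.+ Σ< N λ k → κ (f ⁺ k) (f ⁺ N)
  u = κ (f ⁺ i) (f ⁺ suc i)
  u′ = κ (f ⁺ suc i) (f ⁺ i)

Odd : (Signed → Signed) → Set
Odd f = ∀ a → f (neg a) ≡ neg (f a)

Σ<-s₀ : ∀ (u : Signed → ℕ) f → Odd f → ∀ {N} → 1 ≤′ N →
  Σ< N (λ i → u ((f ∘ s₀) ⁺ i)) ℕ.+ u (f ⁺ 0) ≡ Σ< N (λ i → u (f ⁺ i)) ℕ.+ u (neg (f ⁺ 0))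
Σ<-s₀ u f odd ≤′-refl = trans (cong (ℕ._+ u (f ⁺ 0)) (cong u (odd _))) (ℕ.+-comm (u (neg (f ⁺ 0))) _)
Σ<-s₀ u f odd {suc (suc N)} (≤′-step 1≤N) = begin
  a′ ℕ.+ c ℕ.+ v   ≡⟨ xy∙z≈xz∙y a′ c v ⟩
  a′ ℕ.+ v ℕ.+ c   ≡⟨ cong (ℕ._+ c) (Σ<-s₀ u f odd 1≤N) ⟩
  a ℕ.+ v′ ℕ.+ c   ≡⟨ xy∙z≈xz∙y a v′ c ⟩
  a ℕ.+ c ℕ.+ v′   ∎
  where
  open ≡-Reasoning
  a = Σ< (suc N) λ i → u (f ⁺ i)
  a′ = Σ< (suc N) λ i → u ((f ∘ s₀) ⁺ i)
  c = u (f ⁺ suc N)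
  v = u (f ⁺ 0)
  v′ = u (neg (f ⁺ 0))
Σ<-s₀ u f odd {suc zero} (≤′-step 1≤0) = contradiction (ℕ.≤′⇒≤ 1≤0) λ ()

inv-s₀ : ∀ X f → Odd f → ∀ {N} → 1 ≤′ N →
  inv X N (f ∘ s₀) ℕ.+ long X (f ⁺ 0) ≡ inv X N f ℕ.+ long X (neg (f ⁺ 0))
inv-s₀ X f odd ≤′-refl =
  trans (cong₂ ℕ._+_ (trans (ℕ.+-identityʳ _) (cong (long X) (odd _))) (sym (ℕ.+-identityʳ _)))
        (ℕ.+-comm (long X (neg (f ⁺ 0))) _)
inv-s₀ X f odd {suc (suc N)} (≤′-step 1≤N) = begin
  -- `κ` ignores the sign of its first argument, so the two correction terms of `Σ<-s₀` coincide and
  -- cancel.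
  a′ ℕ.+ (l ℕ.+ c′) ℕ.+ v   ≡⟨ cong (λ c → a′ ℕ.+ (l ℕ.+ c) ℕ.+ v)
                                (ℕ.+-cancelʳ-≡ _ c′ c (Σ<-s₀ (λ a → κ a (f ⁺ suc N)) f odd 1≤N)) ⟩
  a′ ℕ.+ (l ℕ.+ c) ℕ.+ v    ≡⟨ xy∙z≈xz∙y a′ (l ℕ.+ c) v ⟩
  a′ ℕ.+ v ℕ.+ (l ℕ.+ c)    ≡⟨ cong (ℕ._+ (l ℕ.+ c)) (inv-s₀ X f odd 1≤N) ⟩
  a ℕ.+ v′ ℕ.+ (l ℕ.+ c)    ≡⟨ xy∙z≈xz∙y a v′ (l ℕ.+ c) ⟩
  a ℕ.+ (l ℕ.+ c) ℕ.+ v′    ∎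
  where
  open ≡-Reasoning
  a = inv X (suc N) f
  a′ = inv X (suc N) (f ∘ s₀)
  l = long X (f ⁺ suc N)
  c = Σ< (suc N) λ i → κ (f ⁺ i) (f ⁺ suc N)
  c′ = Σ< (suc N) λ i → κ ((f ∘ s₀) ⁺ i) (f ⁺ suc N)
  v = long X (f ⁺ 0)
  v′ = long X (neg (f ⁺ 0))
inv-s₀ X f odd {suc zero} (≤′-step 1≤0) = contradiction (ℕ.≤′⇒≤ 1≤0) λ ()

-- Since `long D` is zero, composing with s₀ does not change `inv D`. As s_1̂ = s₀ s₁ s₀, what
-- remains is `inv-s₊` for `f ∘ s₀` at position 0.
inv-s₁̂ : ∀ f → Odd f → ∀ {N} → 2 ≤′ N →
  inv D N (f ∘ gen D s̃) ℕ.+ κ (f ⁺ 0) (f ⁺ 1) ≡ inv D N f ℕ.+ κ (f ⁺ 1) (neg (f ⁺ 0))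
inv-s₁̂ f odd {N} 2≤N = begin
  inv D N (f ∘ gen D s̃) ℕ.+ κ (f ⁺ 0) (f ⁺ 1)
    ≡⟨ cong (ℕ._+ κ (f ⁺ 0) (f ⁺ 1)) (flip (f ∘ s₀ ∘ s₊ 0) odd₂) ⟩
  inv D N (f ∘ s₀ ∘ s₊ 0) ℕ.+ κ (neg (f ⁺ 0)) (f ⁺ 1)
    ≡⟨ cong (λ a → inv D N (f ∘ s₀ ∘ s₊ 0) ℕ.+ κ a (f ⁺ 1)) (odd _) ⟨
  inv D N (f ∘ s₀ ∘ s₊ 0) ℕ.+ κ ((f ∘ s₀) ⁺ 0) (f ⁺ 1)
    ≡⟨ inv-s₊ D (f ∘ s₀) 2≤N ⟩
  inv D N (f ∘ s₀) ℕ.+ κ (f ⁺ 1) ((f ∘ s₀) ⁺ 0)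
    ≡⟨ cong₂ (λ l a → l ℕ.+ κ (f ⁺ 1) a) (flip f odd) (odd _) ⟩
  inv D N f ℕ.+ κ (f ⁺ 1) (neg (f ⁺ 0))  ∎
  where
  open ≡-Reasoning
  flip : ∀ h → Odd h → inv D N (h ∘ s₀) ≡ inv D N h
  flip h odd = ℕ.+-cancelʳ-≡ _ _ _ (inv-s₀ D h odd (ℕ.≤⇒≤′ (ℕ.<⇒≤ (ℕ.≤′⇒≤ 2≤N))))
  odd₂ : Odd (f ∘ s₀ ∘ s₊ 0)
  odd₂ a = trans (cong f (s₀-odd (s₊ 0 a))) (odd _)

-- Inversions as a lower bound for the length

record IsPerm (f : Signed → Signed) : Set where
  field
    odd       : Odd f
    injective : ∀ {a b} → f a ≡ f b → a ≡ b

open IsPerm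

id-isPerm : IsPerm id
id-isPerm = record { odd = λ _ → refl ; injective = id }

gen-isPerm : ∀ X g → IsPerm (gen X g)
gen-isPerm X g = record
  { odd = gen-odd X g
  ; injective = λ {a} {b} eq →
      trans (sym (gen-involutive X g a)) (trans (cong (gen X g) eq) (gen-involutive X g b)) }

∘-isPerm : ∀ {f g} → IsPerm f → IsPerm g → IsPerm (f ∘ g)
∘-isPerm {f} F G = record
  { odd = λ a → trans (cong f (odd G a)) (odd F _)
  ; injective = injective G ∘ injective F }

rank-injective : ∀ {f} → IsPerm f → ∀ {i j} → proj₂ (f ⁺ i) ≡ proj₂ (f ⁺ j) → i ≡ j
rank-injective {f} F {i} {j} eq with sameRank (f ⁺ i) (f ⁺ j) eq
... | inj₁ e = cong proj₂ (injective F e)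
... | inj₂ e = cong proj₂ (injective F (trans e (sym (odd F _))))

Adjacent : ℕ → ℕ → Set
Adjacent a b = b ≡ suc a ⊎ a ≡ suc b

-- Exactly one of a > b and b > a holds, while [a + b < 0] is symmetric in a and b.
κ-adjacent : ∀ a b → proj₂ a ≢ proj₂ b → Adjacent (κ a b) (κ b a)
κ-adjacent (ε , i) (η , j) i≢j with ℕ.<-cmp i j
... | tri≈ _ i≡j _ = contradiction i≡j i≢j
κ-adjacent (ε , i) (Sign.+ , j) i≢j | tri< i<j _ j≮i
  rewrite κ-< {ε = ε} {Sign.+} i<j | κ-≮ {ε = Sign.+} {ε} j≮i = inj₁ refl
κ-adjacent (ε , i) (Sign.- , j) i≢j | tri< i<j _ j≮i
  rewrite κ-< {ε = ε} {Sign.-} i<j | κ-≮ {ε = Sign.-} {ε} j≮i = inj₂ refl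
κ-adjacent (Sign.+ , i) (η , j) i≢j | tri> i≮j _ j<i
  rewrite κ-< {ε = η} {Sign.+} j<i | κ-≮ {ε = Sign.+} {η} i≮j = inj₂ refl
κ-adjacent (Sign.- , i) (η , j) i≢j | tri> i≮j _ j<i
  rewrite κ-< {ε = η} {Sign.-} j<i | κ-≮ {ε = Sign.-} {η} i≮j = inj₁ refl

adjacent-transfer : ∀ {a b u v} → a ℕ.+ u ≡ b ℕ.+ v → Adjacent u v → a ≤ suc b × b ≤ suc a
adjacent-transfer {a} {b} {u} eq (inj₁ refl) with ℕ.+-cancelʳ-≡ u a (suc b) (trans eq (ℕ.+-suc b u))
... | refl = ℕ.≤-refl , ℕ.≤-trans (ℕ.n≤1+n b) (ℕ.n≤1+n _)
adjacent-transfer {a} {b} {v = v} eq (inj₂ refl)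
  with ℕ.+-cancelʳ-≡ v (suc a) b (trans (sym (ℕ.+-suc a v)) eq)
... | refl = ℕ.≤-trans (ℕ.n≤1+n a) (ℕ.n≤1+n _) , ℕ.≤-refl

isNeg-adjacent : ∀ a → Adjacent (isNeg a) (isNeg (neg a))
isNeg-adjacent (Sign.+ , i) = inj₁ refl
isNeg-adjacent (Sign.- , i) = inj₂ refl

inv-gen : ∀ X {N} → minRank X ≤ N → ∀ {f} → IsPerm f → ∀ g → GenOfRank N g →
  inv X N (f ∘ gen X g) ≤ suc (inv X N f) × inv X N f ≤ suc (inv X N (f ∘ gen X g))
inv-gen X _ {f} F (s i) i<N = adjacent-transfer (inv-s₊ X f (ℕ.≤⇒≤′ i<N))
  (κ-adjacent (f ⁺ i) (f ⁺ suc i) (ℕ.m≢1+n+m i {0} ∘ rank-injective F))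
inv-gen B 1≤N {f} F s̃ _ = adjacent-transfer (inv-s₀ B f (odd F) (ℕ.≤⇒≤′ 1≤N)) (isNeg-adjacent _)
inv-gen C 1≤N {f} F s̃ _ = adjacent-transfer (inv-s₀ C f (odd F) (ℕ.≤⇒≤′ 1≤N)) (isNeg-adjacent _)
inv-gen D 2≤N {f} F s̃ _ = adjacent-transfer (inv-s₁̂ f (odd F) (ℕ.≤⇒≤′ 2≤N)) adj
  where
  adj : Adjacent (κ (f ⁺ 0) (f ⁺ 1)) (κ (f ⁺ 1) (neg (f ⁺ 0)))
  adj = κ-adjacent (neg (f ⁺ 0)) (f ⁺ 1) λ eq → contradiction (rank-injective F eq) λ ()

∏-isPerm : ∀ X as → IsPerm (∏ X as)
∏-isPerm X []       = id-isPerm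
∏-isPerm X (g ∷ as) = ∘-isPerm (gen-isPerm X g) (∏-isPerm X as)

inv-∏ : ∀ X {N} → minRank X ≤ N → ∀ {f} → IsPerm f → ∀ {as} → All (GenOfRank N) as →
  inv X N (f ∘ ∏ X as) ≤ length as ℕ.+ inv X N f
inv-∏ X 1≤N F [] = ℕ.≤-refl
inv-∏ X {N} 1≤N {f} F {g ∷ as} (pg ∷ ps) = begin
  inv X N (f ∘ gen X g ∘ ∏ X as)           ≤⟨ inv-∏ X 1≤N (∘-isPerm F (gen-isPerm X g)) ps ⟩
  length as ℕ.+ inv X N (f ∘ gen X g)      ≤⟨ ℕ.+-monoʳ-≤ (length as) (proj₁ (inv-gen X 1≤N F g pg)) ⟩
  length as ℕ.+ suc (inv X N f)            ≡⟨ ℕ.+-suc (length as) _ ⟩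
  suc (length as ℕ.+ inv X N f)            ∎
  where open ℕ.≤-Reasoning

Fixes≥ : ℕ → (Signed → Signed) → Set
Fixes≥ n f = ∀ ε i → n ≤ i → f (ε , i) ≡ (ε , i)

Σ<-zero : ∀ N {u} → (∀ {j} → j < N → u j ≡ 0) → Σ< N u ≡ 0
Σ<-zero zero    eq = refl
Σ<-zero (suc N) eq = cong₂ ℕ._+_ (Σ<-zero N (eq ∘ ℕ.m<n⇒m<1+n)) (eq (ℕ.n<1+n N))

-- If the rank of `f ⁺ i` were at least `m`, then `f` would fix `f ⁺ i`, and injectivity would force
-- `f ⁺ i` to be i itself, whose rank is below `m`.
fixes-rank : ∀ {n f} → IsPerm f → Fixes≥ n f → ∀ {i m} → i < m → n ≤ m → proj₂ (f ⁺ i) < m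
fixes-rank {f = f} F fix {i} {m} i<m n≤m with proj₂ (f ⁺ i) ℕ.<? m
... | yes <m = <m
... | no ≮m = contradiction
  (cong proj₂ (injective F (fix (proj₁ (f ⁺ i)) (proj₂ (f ⁺ i)) (ℕ.≤-trans n≤m (ℕ.≮⇒≥ ≮m)))))
  λ eq → ≮m (ℕ.<-≤-trans (ℕ.≤-<-trans (ℕ.≤-reflexive eq) i<m) ℕ.≤-refl)

κ-fixed : ∀ {n f} → IsPerm f → Fixes≥ n f → ∀ {i m} → i < m → n ≤ m → κ (f ⁺ i) (f ⁺ m) ≡ 0
κ-fixed {f = f} F fix {i} i<m n≤m rewrite fix Sign.+ _ n≤m =
  κ-< {ε = proj₁ (f ⁺ i)} {Sign.+} (fixes-rank F fix i<m n≤m)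

long-+ : ∀ X i → long X (Sign.+ , i) ≡ 0
long-+ B i = refl
long-+ C i = refl
long-+ D i = refl

-- A fixed positive entry exceeds all earlier ones in absolute value and takes part in no inversion.
-- Hence the count does not depend on the rank in which it is taken.
inv-stable : ∀ X {n f} → IsPerm f → Fixes≥ n f → ∀ {N} → n ≤′ N → inv X N f ≡ inv X n f
inv-stable X F fix ≤′-refl = refl
inv-stable X {n} {f} F fix {suc N} (≤′-step n≤N) =
  trans (cong₂ ℕ._+_ (inv-stable X F fix n≤N)
          (cong₂ ℕ._+_ long≡0 (Σ<-zero N λ i<N → κ-fixed F fix i<N (ℕ.≤′⇒≤ n≤N))))
        (ℕ.+-identityʳ _)
  where
  long≡0 : long X (f ⁺ N) ≡ 0
  long≡0 = trans (cong (long X) (fix Sign.+ N (ℕ.≤′⇒≤ n≤N))) (long-+ X N)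

-- The identity fixes everything from 0 on, so its count is that of rank 0, an empty sum.
inv-id : ∀ X N → inv X N id ≡ 0
inv-id X N = inv-stable X {0} id-isPerm (λ _ _ _ → refl) {N} (ℕ.≤⇒≤′ z≤n)

∏-fixed : ∀ X {n} → minRank X ≤ n → ∀ {as} → All (GenOfRank n) as → Fixes≥ n (∏ X as)
∏-fixed X m≤n [] ε i n≤i = refl
∏-fixed X m≤n {g ∷ as} (pg ∷ ps) ε i n≤i =
  trans (cong (gen X g) (∏-fixed X m≤n ps ε i n≤i)) (gen-fixed X m≤n g pg ε i n≤i)

rankOf : List Gen → ℕ
rankOf []         = 0
rankOf (s̃ ∷ as)   = rankOf as
rankOf (s i ∷ as) = suc (suc i) ⊔ rankOf as

letters-ranked : ∀ as {N} → rankOf as ≤ N → All (GenOfRank N) as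
letters-ranked []         _ = []
letters-ranked (s̃ ∷ as)   ≤N = tt ∷ letters-ranked as ≤N
letters-ranked (s i ∷ as) ≤N =
  ℕ.≤-trans (ℕ.m≤m⊔n _ (rankOf as)) ≤N ∷ letters-ranked as (ℕ.≤-trans (ℕ.m≤n⊔m (suc (suc i)) _) ≤N)

-- The word may leave rank `n`. In a larger rank `N` that holds all its letters the count is the
-- same, and each letter raises it by at most one.
inv-lowerBound : ∀ X {n f} → minRank X ≤ n → IsPerm f → Fixes≥ n f →
  ∀ as → ∏ X as ≗ f → inv X n f ≤ length as
inv-lowerBound X {n} {f} m≤n F fix as eq = begin
  inv X n f                    ≡⟨ inv-stable X F fix (ℕ.≤⇒≤′ n≤N) ⟨
  inv X N f                    ≡⟨ inv-cong X N eq ⟨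
  inv X N (∏ X as)             ≤⟨ inv-∏ X (ℕ.≤-trans m≤n n≤N) id-isPerm
                                    (letters-ranked as (ℕ.m≤n⊔m n (rankOf as))) ⟩
  length as ℕ.+ inv X N id     ≡⟨ cong (length as ℕ.+_) (inv-id X N) ⟩
  length as ℕ.+ 0              ≡⟨ ℕ.+-identityʳ _ ⟩
  length as                    ∎
  where
  open ℕ.≤-Reasoning
  N = n ⊔ rankOf as
  n≤N : n ≤ N
  n≤N = ℕ.m≤m⊔n n _

-- Parity of sign changes and membership in rank `n`

Even : LieType → ℕ → (Signed → Signed) → Set
Even B n f = ⊤
Even C n f = ⊤
Even D n f = 2 ∣ negs n f

even-resp : ∀ X {n f g} → f ≗ g → Even X n f → Even X n g
even-resp B _ _ = tt
even-resp C _ _ = tt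
even-resp D {n} eq 2∣ rewrite negs-cong n eq = 2∣

even-id : ∀ X n → Even X n id
even-id B n = tt
even-id C n = tt
even-id D n rewrite Σ<-zero n {λ _ → 0} (λ _ → refl) = 2 ∣.∣0

-- The entry at 0 contributes 1 - v instead of v; the change 1 - 2v is written without subtraction.
negs-s₀ : ∀ f → Odd f → ∀ {N} → 1 ≤′ N →
  negs N (f ∘ s₀) ℕ.+ 2 ℕ.* isNeg (f ⁺ 0) ≡ suc (negs N f)
negs-s₀ f odd {N} 1≤N = begin
  negs N (f ∘ s₀) ℕ.+ 2 ℕ.* v           ≡⟨ solve 2 (λ a v → a :+ con 2 :* v := a :+ v :+ v) refl
                                               (negs N (f ∘ s₀)) v ⟩
  negs N (f ∘ s₀) ℕ.+ v ℕ.+ v           ≡⟨ cong (ℕ._+ v) (Σ<-s₀ isNeg f odd 1≤N) ⟩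
  negs N f ℕ.+ isNeg (neg (f ⁺ 0)) ℕ.+ v  ≡⟨ ℕ.+-assoc (negs N f) _ _ ⟩
  negs N f ℕ.+ (isNeg (neg (f ⁺ 0)) ℕ.+ v)  ≡⟨ cong (negs N f ℕ.+_) (one (f ⁺ 0)) ⟩
  negs N f ℕ.+ 1                        ≡⟨ ℕ.+-comm (negs N f) 1 ⟩
  suc (negs N f)                        ∎
  where
  open ≡-Reasoning
  open +-*-Solver
  v = isNeg (f ⁺ 0)
  one : ∀ a → isNeg (neg a) ℕ.+ isNeg a ≡ 1
  one (Sign.+ , _) = refl
  one (Sign.- , _) = refl

even-gen : ∀ X {n} → minRank X ≤ n → ∀ {f} → IsPerm f → ∀ g → GenOfRank n g →
  Even X n f → Even X n (f ∘ gen X g)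
even-gen B m≤n F g _ _ = tt
even-gen C m≤n F g _ _ = tt
even-gen D m≤n {f} F (s i) i<n 2∣ rewrite Σ<-swap (λ i → isNeg (f ⁺ i)) (ℕ.≤⇒≤′ i<n) = 2∣
even-gen D {n} 2≤n {f} F s̃ _ 2∣ =
  -- The word s₀ s₁ s₀ flips two signs, so its two uses of `negs-s₀` together change the count by an
  -- even number.
  ∣.∣m+n∣m⇒∣n (∣.∣-trans 2∣ᵣ (∣.∣-reflexive (sym eq))) (∣.m∣m*n (v₂ ℕ.+ v₁))
  where
  open ≡-Reasoning
  open +-*-Solver
  h = f ∘ s₀ ∘ s₊ 0
  H : IsPerm h
  H = ∘-isPerm (∘-isPerm F (gen-isPerm B s̃)) (gen-isPerm B (s 0))
  v₁ = isNeg (f ⁺ 0)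
  v₂ = isNeg (h ⁺ 0)
  1≤n : 1 ≤′ n
  1≤n = ℕ.≤⇒≤′ (ℕ.<⇒≤ 2≤n)
  2∣ᵣ : 2 ∣ 2 ℕ.+ negs n f
  2∣ᵣ = ∣.∣m∣n⇒∣m+n ∣.∣-refl 2∣
  eq : 2 ℕ.* (v₂ ℕ.+ v₁) ℕ.+ negs n (f ∘ gen D s̃) ≡ 2 ℕ.+ negs n f
  eq = begin
    2 ℕ.* (v₂ ℕ.+ v₁) ℕ.+ negs n (h ∘ s₀)
      ≡⟨ solve 3 (λ a b c → con 2 :* (b :+ c) :+ a := a :+ con 2 :* b :+ con 2 :* c) refl
           (negs n (h ∘ s₀)) v₂ v₁ ⟩
    negs n (h ∘ s₀) ℕ.+ 2 ℕ.* v₂ ℕ.+ 2 ℕ.* v₁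
      ≡⟨ cong (ℕ._+ 2 ℕ.* v₁) (negs-s₀ h (odd H) 1≤n) ⟩
    suc (negs n h) ℕ.+ 2 ℕ.* v₁
      ≡⟨ cong (λ k → suc k ℕ.+ 2 ℕ.* v₁) (Σ<-swap (λ i → isNeg ((f ∘ s₀) ⁺ i)) (ℕ.≤⇒≤′ 2≤n)) ⟩
    suc (negs n (f ∘ s₀) ℕ.+ 2 ℕ.* v₁)
      ≡⟨ cong suc (negs-s₀ f (odd F) 1≤n) ⟩
    2 ℕ.+ negs n f ∎

-- Membership in the group of rank `n` for a bare map. No inverse is recorded: an odd injection that
-- fixes every rank from `n` on is bijective.
record Elem (X : LieType) (n : ℕ) (f : Signed → Signed) : Set where
  field
    isPerm : IsPerm f
    fixes  : Fixes≥ n f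
    even   : Even X n f

open Elem

elem-resp : ∀ {X n f g} → f ≗ g → Elem X n f → Elem X n g
elem-resp {X} eq F = record
  { isPerm = record
    { odd = λ a → trans (sym (eq _)) (trans (odd (isPerm F) a) (cong neg (eq a)))
    ; injective = λ e → injective (isPerm F) (trans (eq _) (trans e (sym (eq _)))) }
  ; fixes = λ ε i n≤i → trans (sym (eq _)) (fixes F ε i n≤i)
  ; even = even-resp X eq (even F) }

-- The inequality says a < b, and this is decided by the sign of the entry of larger absolute value.
κ-asc : ∀ a b → proj₂ a ≢ proj₂ b → κ a b ≤ κ b a →
  (proj₂ a < proj₂ b × isNeg b ≡ 0) ⊎ (proj₂ b < proj₂ a × isNeg a ≡ 1)
κ-asc (ε , i) (η , j) i≢j le with ℕ.<-cmp i j
... | tri≈ _ i≡j _ = contradiction i≡j i≢j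
κ-asc (ε , i) (Sign.+ , j) i≢j le | tri< i<j _ j≮i = inj₁ (i<j , refl)
κ-asc (ε , i) (Sign.- , j) i≢j le | tri< i<j _ j≮i
  rewrite κ-< {ε = ε} {Sign.-} i<j | κ-≮ {ε = Sign.-} {ε} j≮i with () ← ℕ.≤-pred le
κ-asc (Sign.+ , i) (η , j) i≢j le | tri> i≮j _ j<i
  rewrite κ-< {ε = η} {Sign.+} j<i | κ-≮ {ε = Sign.+} {η} i≮j with () ← le
κ-asc (Sign.- , i) (η , j) i≢j le | tri> i≮j _ j<i = inj₂ (j<i , refl)

transfer-≤ : ∀ {a b u v} → a ℕ.+ u ≡ b ℕ.+ v → b ≤ a → u ≤ v
transfer-≤ {a} {b} {u} {v} eq b≤a = ℕ.+-cancelˡ-≤ b u v (begin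
  b ℕ.+ u  ≤⟨ ℕ.+-monoˡ-≤ u b≤a ⟩
  a ℕ.+ u  ≡⟨ eq ⟩
  b ℕ.+ v  ∎)
  where open ℕ.≤-Reasoning

transfer-≥ : ∀ {a b u v} → a ℕ.+ u ≡ b ℕ.+ v → u ≤ v → b ≤ a
transfer-≥ {a} {b} {u} {v} eq u≤v = ℕ.+-cancelʳ-≤ u b a (begin
  b ℕ.+ u  ≤⟨ ℕ.+-monoʳ-≤ b u≤v ⟩
  b ℕ.+ v  ≡⟨ eq ⟨
  a ℕ.+ u  ∎)
  where open ℕ.≤-Reasoning

-- Strict growth gives i ≤ r(i). If r(i) exceeded i, the excess would persist for `n` further steps,
-- into the range where `r` is the identity.
increasing⇒id : ∀ {r : ℕ → ℕ} n → (∀ i → r i < r (suc i)) → (∀ i → n ≤ i → r i ≡ i) → ∀ i → r i ≡ i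
increasing⇒id {r} n inc eq i = ℕ.≤-antisym (ℕ.+-cancelˡ-≤ n _ _ upper) (lower i)
  where
  open ℕ.≤-Reasoning
  lower : ∀ i → i ≤ r i
  lower zero    = z≤n
  lower (suc i) = ℕ.≤-trans (s≤s (lower i)) (inc i)
  climb : ∀ d → d ℕ.+ r i ≤ r (d ℕ.+ i)
  climb zero    = ℕ.≤-refl
  climb (suc d) = ℕ.≤-trans (s≤s (climb d)) (inc _)
  upper : n ℕ.+ r i ≤ n ℕ.+ i
  upper = begin
    n ℕ.+ r i    ≤⟨ climb n ⟩
    r (n ℕ.+ i)  ≡⟨ eq _ (ℕ.m≤m+n n i) ⟩
    n ℕ.+ i      ∎

Σ<-head : ∀ N {u} → (∀ j → u (suc j) ≡ 0) → Σ< (suc N) u ≡ u 0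
Σ<-head zero    eq = refl
Σ<-head (suc N) eq = trans (cong₂ ℕ._+_ (Σ<-head N eq) (eq N)) (ℕ.+-identityʳ _)

positive : ∀ {a i} → isNeg a ≡ 0 → proj₂ a ≡ i → a ≡ (Sign.+ , i)
positive {Sign.+ , i} _ refl = refl

module _ {X : LieType} {n : ℕ} {f : Signed → Signed} (m≤n : minRank X ≤ n) (F : Elem X n f)
         (noDescent : ∀ g → GenOfRank n g → inv X n f ≤ inv X n (f ∘ gen X g)) where

  private
    P = isPerm F

  ascent : ∀ i → (proj₂ (f ⁺ i) < proj₂ (f ⁺ suc i) × isNeg (f ⁺ suc i) ≡ 0)
               ⊎ (proj₂ (f ⁺ suc i) < proj₂ (f ⁺ i) × isNeg (f ⁺ i) ≡ 1)
  ascent i with suc i ℕ.<? n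
  ... | yes i<n = κ-asc (f ⁺ i) (f ⁺ suc i) (ℕ.m≢1+n+m i {0} ∘ rank-injective P)
          (transfer-≤ (inv-s₊ X f (ℕ.≤⇒≤′ i<n)) (noDescent (s i) i<n))
  ... | no i≮n = inj₁ (ascent-fixed (fixes F Sign.+ (suc i) (ℕ.≮⇒≥ i≮n)))
    where
    ascent-fixed : f ⁺ suc i ≡ (Sign.+ , suc i) → proj₂ (f ⁺ i) < proj₂ (f ⁺ suc i) × isNeg (f ⁺ suc i) ≡ 0
    ascent-fixed eq rewrite eq = fixes-rank P (fixes F) (ℕ.n<1+n i) (ℕ.≮⇒≥ i≮n) , refl

  ascent⁺ : ∀ i → isNeg (f ⁺ i) ≡ 0 → proj₂ (f ⁺ i) < proj₂ (f ⁺ suc i) × isNeg (f ⁺ suc i) ≡ 0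
  ascent⁺ i pos with ascent i
  ... | inj₁ asc = asc
  ... | inj₂ (_ , neg) = contradiction (trans (sym pos) neg) λ ()

  ascents : ∀ i → isNeg (f ⁺ i) ≡ 0 → ∀ d → isNeg (f ⁺ (d ℕ.+ i)) ≡ 0
  ascents i pos zero    = pos
  ascents i pos (suc d) = proj₂ (ascent⁺ (d ℕ.+ i) (ascents i pos d))

  ascents₀ : isNeg (f ⁺ 0) ≡ 0 → ∀ i → isNeg (f ⁺ i) ≡ 0
  ascents₀ pos zero    = pos
  ascents₀ pos (suc i) = proj₂ (ascent⁺ i (ascents₀ pos i))

  -- The values f(1) < f(2) < ... start positive, so their absolute values increase strictly, and
  -- `increasing⇒id` applies to them.
  noDescent⇒id⁺ : isNeg (f ⁺ 0) ≡ 0 → f ≗ id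
  noDescent⇒id⁺ pos = λ where
      (Sign.+ , i) → f⁺≡ i
      (Sign.- , i) → trans (odd P (Sign.+ , i)) (cong neg (f⁺≡ i))
    where
    f⁺≡ : ∀ i → f ⁺ i ≡ (Sign.+ , i)
    f⁺≡ i = positive (ascents₀ pos i) (increasing⇒id n
      (λ j → proj₁ (ascent⁺ j (ascents₀ pos j)))
      (λ j n≤j → cong proj₂ (fixes F _ j n≤j)) i)

isNeg-asc : ∀ a → isNeg a ≤ isNeg (neg a) → isNeg a ≡ 0
isNeg-asc (Sign.+ , _) _ = refl

-- In types B and C the generator s₀ decides the sign of f(1). In type D, no descent at s₁ and s_1̂
-- means f(1) < f(2) and -f(1) < f(2), so f(2) and all later values are positive; a negative f(1)
-- would then be the only sign change, against evenness.
noDescent⇒pos : ∀ X {n f} → minRank X ≤ n → Elem X n f →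
  (∀ g → GenOfRank n g → inv X n f ≤ inv X n (f ∘ gen X g)) → isNeg (f ⁺ 0) ≡ 0
noDescent⇒pos B {f = f} 1≤n F nd = isNeg-asc (f ⁺ 0)
  (transfer-≤ (inv-s₀ B f (odd (isPerm F)) (ℕ.≤⇒≤′ 1≤n)) (nd s̃ tt))
noDescent⇒pos C {f = f} 1≤n F nd = isNeg-asc (f ⁺ 0)
  (transfer-≤ (inv-s₀ C f (odd (isPerm F)) (ℕ.≤⇒≤′ 1≤n)) (nd s̃ tt))
noDescent⇒pos D {suc n} {f} 2≤n F nd = even⇒pos (f ⁺ 0) (∣.∣-trans (even F) (∣.∣-reflexive
    (Σ<-head n λ j → trans (cong (λ k → isNeg (f ⁺ k)) (ℕ.+-comm 1 j)) (ascents 2≤n F nd 1 pos₁ j))))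
  where
  P = isPerm F
  even⇒pos : ∀ a → 2 ∣ isNeg a → isNeg a ≡ 0
  even⇒pos (Sign.+ , _) _ = refl
  even⇒pos (Sign.- , _) 2∣1 = contradiction (∣.∣⇒≤ 2∣1) λ { (s≤s ()) }
  ¬both : ∀ a → isNeg a ≡ 1 → isNeg (neg a) ≡ 1 → ⊥
  ¬both (Sign.- , _) _ ()
  pos₁ : isNeg (f ⁺ 1) ≡ 0
  pos₁ with ascent 2≤n F nd 0
          | κ-asc (neg (f ⁺ 0)) (f ⁺ 1) (λ eq → contradiction (rank-injective P eq) λ ())
              (transfer-≤ (inv-s₁̂ f (odd P) (ℕ.≤⇒≤′ 2≤n)) (nd s̃ tt))
  ... | inj₁ (_ , pos) | _ = pos
  ... | inj₂ _ | inj₁ (_ , pos) = pos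
  ... | inj₂ (_ , neg₀) | inj₂ (_ , neg₁) = ⊥-elim (¬both (f ⁺ 0) neg₀ neg₁)

noDescent⇒id : ∀ {X n f} → minRank X ≤ n → Elem X n f →
  (∀ g → GenOfRank n g → inv X n f ≤ inv X n (f ∘ gen X g)) → f ≗ id
noDescent⇒id {X} m≤n F nd = noDescent⇒id⁺ m≤n F nd pos
  where pos = noDescent⇒pos X m≤n F nd

-- Words of length `inv`

module _ {X : LieType} {n : ℕ} (m≤n : minRank X ≤ n) where

  elem-id : Elem X n id
  elem-id = record { isPerm = id-isPerm ; fixes = λ _ _ _ → refl ; even = even-id X n }

  elem-gen : ∀ {f} → Elem X n f → ∀ g → GenOfRank n g → Elem X n (f ∘ gen X g)
  elem-gen {f} F g pg = record
    { isPerm = ∘-isPerm (isPerm F) (gen-isPerm X g)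
    ; fixes = λ ε i n≤i → trans (cong f (gen-fixed X m≤n g pg ε i n≤i)) (fixes F ε i n≤i)
    ; even = even-gen X m≤n (isPerm F) g pg (even F) }

  elem-∏ : ∀ {f} → Elem X n f → ∀ {as} → All (GenOfRank n) as → Elem X n (f ∘ ∏ X as)
  elem-∏ F []        = F
  elem-∏ F (pg ∷ ps) = elem-∏ (elem-gen F _ pg) ps

  ∏-++ : ∀ as bs → ∏ X (as ++ bs) ≗ ∏ X as ∘ ∏ X bs
  ∏-++ []       bs a = refl
  ∏-++ (g ∷ as) bs a = cong (gen X g) (∏-++ as bs a)

  Descent : (Signed → Signed) → Gen → Set
  Descent f g = GenOfRank n g × inv X n (f ∘ gen X g) < inv X n f

  descent? : ∀ f → (∃[ g ] Descent f g) ⊎ (∀ g → GenOfRank n g → inv X n f ≤ inv X n (f ∘ gen X g))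
  descent? f with inv X n (f ∘ gen X s̃) ℕ.<? inv X n f
  ... | yes lt = inj₁ (s̃ , tt , lt)
  ... | no ≮₀ with ℕ.anyUpTo? (λ i → (suc i ℕ.<? n) ×-dec (inv X n (f ∘ s₊ i) ℕ.<? inv X n f)) n
  ...   | yes (i , _ , i<n , lt) = inj₁ (s i , i<n , lt)
  ...   | no none = inj₂ λ where
    s̃     _   → ℕ.≮⇒≥ ≮₀
    (s i) i<n → ℕ.≮⇒≥ λ lt → none (i , ℕ.<-trans (ℕ.n<1+n i) i<n , i<n , lt)

  record ShortWord (f : Signed → Signed) : Set where
    field
      spelling : List Gen
      ranked  : All (GenOfRank n) spelling
      product : ∏ X spelling ≗ f
      len     : length spelling ≡ inv X n f

  open ShortWord

  -- Removing a right descent lowers `inv` by exactly one, and a map without descents is the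
  -- identity. Together with `inv-lowerBound` this identifies `inv` with the length.
  shortWord : ∀ {f} → Elem X n f → ShortWord f
  shortWord F = go F (<-wellFounded _)
    where
    go : ∀ {f} → Elem X n f → Acc _<_ (inv X n f) → ShortWord f
    go {f} F (acc rec) with descent? f
    ... | inj₂ nd = record
      { spelling = [] ; ranked = [] ; product = λ a → sym (f≗id a)
      ; len = sym (trans (inv-cong X n f≗id) (inv-id X n)) }
      where f≗id = noDescent⇒id m≤n F nd
    ... | inj₁ (g , pg , lt) = record
      { spelling = spelling W ++ [ g ]
      ; ranked  = All.++⁺ (ranked W) (pg ∷ [])
      ; product = λ a → trans (∏-++ (spelling W) [ g ] a)
                    (trans (product W _) (cong f (gen-involutive X g a)))
      ; len     = trans (List.length-++ (spelling W)) (trans (ℕ.+-comm _ 1)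
                    (trans (cong suc (len W))
                      (ℕ.≤-antisym lt (proj₂ (inv-gen X m≤n (isPerm F) g pg))))) }
      where W = go (elem-gen F g pg) (rec lt)

  -- The direct counts concern composition on the right; multiplication on the left is reduced to
  -- them by prepending `g` to a word for `f`.
  elem-∘ : ∀ {f} → Elem X n f → ∀ g → GenOfRank n g → Elem X n (gen X g ∘ f)
  elem-∘ F g pg = elem-resp (λ a → cong (gen X g) (product W a))
                    (elem-∏ elem-id (pg ∷ ranked W))
    where W = shortWord F

  inv≤length : ∀ {f} → Elem X n f → ∀ {as} → ∏ X as ≗ f → inv X n f ≤ length as
  inv≤length F {as} = inv-lowerBound X m≤n (isPerm F) (fixes F) as

  inv≡0⇒id : ∀ {f} → Elem X n f → inv X n f ≡ 0 → f ≗ id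
  inv≡0⇒id F eq with shortWord F
  ... | record { spelling = [] ; product = e } = λ a → sym (e a)
  ... | record { spelling = g ∷ as ; len = l } = contradiction (trans l eq) λ ()

  reverse-inverse : ∀ as → ∏ X (reverse as) ∘ ∏ X as ≗ id
  reverse-inverse []       a = refl
  reverse-inverse (g ∷ as) a = begin
    ∏ X (reverse (g ∷ as)) (gen X g (∏ X as a))
      ≡⟨ cong (λ bs → ∏ X bs (gen X g (∏ X as a))) (List.unfold-reverse g as) ⟩
    ∏ X (reverse as ++ [ g ]) (gen X g (∏ X as a))  ≡⟨ ∏-++ (reverse as) [ g ] _ ⟩
    ∏ X (reverse as) (gen X g (gen X g (∏ X as a)))
      ≡⟨ cong (∏ X (reverse as)) (gen-involutive X g _) ⟩
    ∏ X (reverse as) (∏ X as a)                     ≡⟨ reverse-inverse as a ⟩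
    a                                               ∎
    where open ≡-Reasoning

  reverse-inverse′ : ∀ as → ∏ X as ∘ ∏ X (reverse as) ≗ id
  reverse-inverse′ as a = trans
    (cong (λ bs → ∏ X bs (∏ X (reverse as) a)) (sym (List.reverse-involutive as)))
    (reverse-inverse (reverse as) a)

  reverse-ranked : ∀ {as} → All (GenOfRank n) as → All (GenOfRank n) (reverse as)
  reverse-ranked []        = []
  reverse-ranked {g ∷ as} (pg ∷ ps) rewrite List.unfold-reverse g as =
    All.++⁺ (reverse-ranked ps) (pg ∷ [])

  -- Here `g` is some `s i` with `f` fixing position `i + 1`, while the entry at `i` has smaller
  -- absolute value. So `g` is an ascent once the count is taken in a rank `N` that contains `g` and
  -- the letters of the word.
  outsideʳ : ∀ {f} → Elem X n f → ∀ {g} → ¬ GenOfRank n g →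
    ∀ {as} → ∏ X as ≗ f ∘ gen X g → inv X n f ≤ length as
  outsideʳ F {s̃} out _ = contradiction tt out
  outsideʳ {f} F {s i} out {as} eq = begin
    inv X n f             ≡⟨ inv-stable X (isPerm F) (fixes F) (ℕ.≤⇒≤′ n≤N) ⟨
    inv X N f             ≤⟨ transfer-≥ (inv-s₊ X f (ℕ.≤⇒≤′ (ℕ.m≤m⊔n (2 ℕ.+ i) (n ⊔ rankOf as)))) asc ⟩
    inv X N (f ∘ s₊ i)    ≡⟨ inv-cong X N eq ⟨
    inv X N (∏ X as)      ≤⟨ inv-lowerBound X (ℕ.≤-trans m≤n n≤N) (∏-isPerm X as)
                               (∏-fixed X (ℕ.≤-trans m≤n n≤N)
                                 (letters-ranked as (ℕ.≤-trans (ℕ.m≤n⊔m n _) (ℕ.m≤n⊔m (2 ℕ.+ i) _))))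
                               as (λ _ → refl) ⟩
    length as             ∎
    where
    open ℕ.≤-Reasoning
    N = 2 ℕ.+ i ⊔ (n ⊔ rankOf as)
    n≤N : n ≤ N
    n≤N = ℕ.≤-trans (ℕ.m≤m⊔n n _) (ℕ.m≤n⊔m (2 ℕ.+ i) _)
    asc : κ (f ⁺ i) (f ⁺ suc i) ≤ κ (f ⁺ suc i) (f ⁺ i)
    asc rewrite κ-fixed (isPerm F) (fixes F) (ℕ.n<1+n i) (ℕ.≮⇒≥ out) = z≤n

  -- Reduced to `outsideʳ` by inversion: reversing a word inverts its product, so `f` is no longer
  -- than f⁻¹, and s_g f turns into f⁻¹ s_g.
  outsideˡ : ∀ {f} → Elem X n f → ∀ {g} → ¬ GenOfRank n g →
    ∀ {as} → ∏ X as ≗ gen X g ∘ f → inv X n f ≤ length as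
  outsideˡ {f} F {g} out {as} eq = begin
    inv X n f                        ≤⟨ inv≤length F {reverse (spelling V)} f≗ ⟩
    length (reverse (spelling V))     ≡⟨ List.length-reverse (spelling V) ⟩
    length (spelling V)               ≡⟨ len V ⟩
    inv X n f⁻¹                      ≤⟨ outsideʳ F⁻¹ out {reverse as} f⁻¹g≗ ⟩
    length (reverse as)              ≡⟨ List.length-reverse as ⟩
    length as                        ∎
    where
    open ℕ.≤-Reasoning
    W = shortWord F
    f⁻¹ = ∏ X (reverse (spelling W))
    F⁻¹ : Elem X n f⁻¹
    F⁻¹ = elem-∏ elem-id (reverse-ranked (ranked W))
    V = shortWord F⁻¹
    f⁻¹∘f : ∀ a → f⁻¹ (f a) ≡ a
    f⁻¹∘f a = trans (cong f⁻¹ (sym (product W a))) (reverse-inverse (spelling W) a)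
    f∘f⁻¹ : ∀ a → f (f⁻¹ a) ≡ a
    f∘f⁻¹ a = trans (sym (product W _)) (reverse-inverse′ (spelling W) a)
    f≗ : ∏ X (reverse (spelling V)) ≗ f
    f≗ a = trans (cong (∏ X (reverse (spelling V))) (sym (trans (product V (f a)) (f⁻¹∘f a))))
                 (reverse-inverse (spelling V) (f a))
    f⁻¹g≗ : ∏ X (reverse as) ≗ f⁻¹ ∘ gen X g
    f⁻¹g≗ a = trans (cong (∏ X (reverse as)) (sym (trans (eq _)
                (trans (cong (gen X g) (f∘f⁻¹ _)) (gen-involutive X g a)))))
              (reverse-inverse as _)


-- Reduced words

rank? : ∀ n g → Dec (GenOfRank n g)
rank? n s̃     = yes tt
rank? n (s i) = suc i ℕ.<? n

negatives≡negs : ∀ n w → negatives n w ≡ negs n (SignedPerm.to w)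
negatives≡negs zero    w = refl
negatives≡negs (suc n) w = begin
  length (filter neg? (upTo (suc n)))              ≡⟨ cong (length ∘ filter neg?) (List.upTo-∷ʳ n) ⟨
  length (filter neg? (upTo n ++ [ n ]))           ≡⟨ cong length (List.filter-++ neg? (upTo n) [ n ]) ⟩
  length (filter neg? (upTo n) ++ filter neg? [ n ])  ≡⟨ List.length-++ (filter neg? (upTo n)) ⟩
  negatives n w ℕ.+ length (filter neg? [ n ])     ≡⟨ cong₂ ℕ._+_ (negatives≡negs n w) last ⟩
  negs (suc n) (SignedPerm.to w)                   ∎
  where
  open ≡-Reasoning
  neg? : ∀ i → Dec (proj₁ (SignedPerm.to w (Sign.+ , i)) ≡ Sign.-)
  neg? i = proj₁ (SignedPerm.to w (Sign.+ , i)) Sign.≟ Sign.-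
  last : length (filter neg? [ n ]) ≡ isNeg (SignedPerm.to w (Sign.+ , n))
  last with SignedPerm.to w (Sign.+ , n)
  ... | Sign.+ , _ = refl
  ... | Sign.- , _ = refl

toElem : ∀ X {n} w → InGroup X n w → Elem X n (SignedPerm.to w)
toElem X {n} w mem = record { isPerm = isPerm′ ; fixes = fixes′ X mem ; even = even′ X mem }
  where
  isPerm′ : IsPerm (SignedPerm.to w)
  isPerm′ = record
    { odd = SignedPerm.odd w
    ; injective = λ {a} {b} eq → trans (sym (Inverse.strictlyInverseʳ (SignedPerm.perm w) a))
        (trans (cong (Inverse.from (SignedPerm.perm w)) eq)
          (Inverse.strictlyInverseʳ (SignedPerm.perm w) b)) }
  fixes′ : ∀ X → InGroup X n w → Fixes≥ n (SignedPerm.to w)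
  fixes′ B mem = mem
  fixes′ C mem = mem
  fixes′ D mem = proj₁ mem
  even′ : ∀ X → InGroup X n w → Even X n (SignedPerm.to w)
  even′ B mem = tt
  even′ C mem = tt
  even′ D (_ , 2∣) rewrite negatives≡negs n w = 2∣

fromElem : ∀ X {n} w → Elem X n (SignedPerm.to w) → InGroup X n w
fromElem B w F = fixes F
fromElem C w F = fixes F
fromElem D {n} w F = fixes F , even′
  where
  even′ : 2 ∣ negatives n w
  even′ rewrite negatives≡negs n w = even F

genPerm : LieType → Gen → SignedPerm
genPerm X g = record
  { perm = mk↔ₛ′ (gen X g) (gen X g) (gen-involutive X g) (gen-involutive X g)
  ; odd = gen-odd X g }

_∙_ : SignedPerm → SignedPerm → SignedPerm
v ∙ w = record
  { perm = mk↔ₛ′ (V.to ∘ W.to) (W.from ∘ V.from)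
      (λ a → trans (cong V.to (W.strictlyInverseˡ _)) (V.strictlyInverseˡ a))
      (λ a → trans (cong W.from (V.strictlyInverseʳ _)) (W.strictlyInverseʳ a))
  ; odd = λ a → trans (cong V.to (SignedPerm.odd w a)) (SignedPerm.odd v _) }
  where
  module V = Inverse (SignedPerm.perm v)
  module W = Inverse (SignedPerm.perm w)

module Parabolic (X : LieType) (n : ℕ) (m≤n : minRank X ≤ n) where

  -- The field `bounded` of `Group∞` names some rank, possibly a different one. Here membership in
  -- the fixed rank `n` is attached, while `𝔉` can still be applied to `group∞`.
  record 𝔽 : Set where
    constructor _∈𝔽_
    field
      group∞  : Group∞ X
      inGroup : InGroup X n (signedPerm group∞)

  open 𝔽 public

  fun : 𝔽 → Signed → Signed
  fun w = ⟪ group∞ w ⟫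

  elem : ∀ w → Elem X n (fun w)
  elem w = toElem X (signedPerm (group∞ w)) (inGroup w)

  fromPerm : ∀ w → Elem X n (SignedPerm.to w) → 𝔽
  fromPerm w F = record
    { group∞ = record { signedPerm = w ; bounded = n , m≤n , fromElem X w F } ; inGroup = fromElem X w F }

  mulʳ : (w : 𝔽) (g : Gen) → GenOfRank n g → 𝔽
  mulʳ w g pg = fromPerm (signedPerm (group∞ w) ∙ genPerm X g) (elem-gen m≤n (elem w) g pg)

  mulˡ : (g : Gen) → GenOfRank n g → 𝔽 → 𝔽
  mulˡ g pg w = fromPerm (genPerm X g ∙ signedPerm (group∞ w)) (elem-∘ m≤n (elem w) g pg)

  ℓ : (Signed → Signed) → ℕ
  ℓ = inv X n

  Red : List Gen → (Signed → Signed) → Set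
  Red as f = IsReducedWord X (GenOfRank n) as f

  module _ {G : Pred Gen 0ℓ} {f : Signed → Signed} (F : Elem X n f) where

    -- `G` is `GenOfRank n` for pipe dreams and `U` for the recurrences; this is where the two
    -- notions of length meet.
    reduced⇒length : (∀ {g} → GenOfRank n g → G g) → ∀ {as} → IsReducedWord X G as f → length as ≡ ℓ f
    reduced⇒length ⊆G {as} R = ℕ.≤-antisym
      (ℕ.≤-trans (R.shortest _ (All.map ⊆G W.ranked) W.product) (ℕ.≤-reflexive W.len))
      (inv≤length m≤n F {as} R.product)
      where
      module W = ShortWord (shortWord m≤n F)
      module R = IsReducedWord R

    length⇒reduced : ∀ {as} → All G as → ∏ X as ≗ f → length as ≡ ℓ f → IsReducedWord X G as f
    length⇒reduced ps eq l = record
      { letters = ps ; product = eq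
      ; shortest = λ bs _ e → ℕ.≤-trans (ℕ.≤-reflexive l) (inv≤length m≤n F {bs} e) }

  ℓ-mulˡ : ∀ {f} → Elem X n f → ∀ g → GenOfRank n g → ℓ f ≤ suc (ℓ (gen X g ∘ f))
  ℓ-mulˡ {f} F g pg = ℕ.≤-trans
    (inv≤length m≤n F {g ∷ W.spelling}
      (λ a → trans (cong (gen X g) (W.product a)) (gen-involutive X g (f a))))
    (s≤s (ℕ.≤-reflexive W.len))
    where module W = ShortWord (shortWord m≤n (elem-∘ m≤n F g pg))

  ℓ-mulʳ : ∀ {f} → Elem X n f → ∀ g → GenOfRank n g → ℓ f ≤ suc (ℓ (f ∘ gen X g))
  ℓ-mulʳ F g pg = proj₂ (inv-gen X m≤n (isPerm F) g pg)

  module _ {f : Signed → Signed} (F : Elem X n f) {g : Gen} {as : List Gen} where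

    open ≡-Reasoning

    red-uncons : Red (g ∷ as) f → GenOfRank n g × ℓ (gen X g ∘ f) < ℓ f × Red as (gen X g ∘ f)
    red-uncons R with IsReducedWord.letters R
    ... | pg ∷ ps = pg , lt , length⇒reduced F′ ps eq
                      (ℕ.≤-antisym (ℕ.≤-pred (ℕ.≤-trans (ℕ.≤-reflexive l) (ℓ-mulˡ F g pg))) le)
      where
      l = reduced⇒length F id R
      F′ = elem-∘ m≤n F g pg
      eq : ∏ X as ≗ gen X g ∘ f
      eq a = trans (sym (gen-involutive X g _)) (cong (gen X g) (IsReducedWord.product R a))
      le = inv≤length m≤n F′ {as} eq
      lt : ℓ (gen X g ∘ f) < ℓ f
      lt = ℕ.≤-trans (s≤s le) (ℕ.≤-reflexive l)

    red-cons : GenOfRank n g → ℓ (gen X g ∘ f) < ℓ f → Red as (gen X g ∘ f) → Red (g ∷ as) f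
    red-cons pg lt R = length⇒reduced F (pg ∷ R.letters)
      (λ a → trans (cong (gen X g) (R.product a)) (gen-involutive X g (f a)))
      (trans (cong suc (reduced⇒length (elem-∘ m≤n F g pg) id R)) (ℕ.≤-antisym lt (ℓ-mulˡ F g pg)))
      where module R = IsReducedWord R

    red-unsnoc : GenOfRank n g → Red (as ++ [ g ]) f → ℓ (f ∘ gen X g) < ℓ f × Red as (f ∘ gen X g)
    red-unsnoc pg R = lt , length⇒reduced F′ (All.++⁻ˡ as R.letters) eq
      (ℕ.≤-antisym (ℕ.≤-pred (ℕ.≤-trans (ℕ.≤-reflexive l) (ℓ-mulʳ F g pg))) le)
      where
      module R = IsReducedWord R
      l : suc (length as) ≡ ℓ f
      l = trans (ℕ.+-comm 1 _) (trans (sym (List.length-++ as)) (reduced⇒length F id R))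
      F′ = elem-gen m≤n F g pg
      eq : ∏ X as ≗ f ∘ gen X g
      eq a = trans (cong (∏ X as) (sym (gen-involutive X g a)))
        (trans (sym (∏-++ m≤n as [ g ] _)) (R.product _))
      le = inv≤length m≤n F′ {as} eq
      lt : ℓ (f ∘ gen X g) < ℓ f
      lt = ℕ.≤-trans (s≤s le) (ℕ.≤-reflexive l)

    red-snoc : GenOfRank n g → ℓ (f ∘ gen X g) < ℓ f → Red as (f ∘ gen X g) → Red (as ++ [ g ]) f
    red-snoc pg lt R = length⇒reduced F (All.++⁺ R.letters (pg ∷ []))
      (λ a → trans (∏-++ m≤n as [ g ] a) (trans (R.product _) (cong f (gen-involutive X g a))))
      (trans (List.length-++ as) (trans (ℕ.+-comm (length as) 1)
        (trans (cong suc (reduced⇒length (elem-gen m≤n F g pg) id R)) (ℕ.≤-antisym lt (ℓ-mulʳ F g pg)))))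
      where module R = IsReducedWord R

  -- `shortest` quantifies over all words and cannot be tested directly. Instead, a word beginning
  -- with `g` is reduced for `f` exactly if `g` has rank `n`, is a left descent, and the rest is
  -- reduced for s_g f.
  red? : ∀ as {f} → Elem X n f → Dec (Red as f)
  red? [] {f} F = map′
    (λ l≡0 → length⇒reduced F [] (λ a → sym (inv≡0⇒id m≤n F l≡0 a)) (sym l≡0))
    (λ R → sym (reduced⇒length F id R))
    (ℓ f ℕ.≟ 0)
  red? (g ∷ as) {f} F with rank? n g
  ... | no ¬pg = no λ R → ¬pg (proj₁ (red-uncons F R))
  ... | yes pg = map′ (λ (lt , R) → red-cons F pg lt R) (λ R → proj₂ (red-uncons F R))
    ((ℓ (gen X g ∘ f) ℕ.<? ℓ f) ×-dec red? as (elem-∘ m≤n F g pg))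

  length<⇒shorter : ∀ {f h} → Elem X n f → Elem X n h → ℓ f < ℓ h → Shorter X f h
  length<⇒shorter {f} {h} F H lt = V.spelling , W.spelling ,
      length⇒reduced F (All.map _ V.ranked) V.product V.len ,
      length⇒reduced H (All.map _ W.ranked) W.product W.len ,
      ℕ.≤-trans (s≤s (ℕ.≤-reflexive V.len)) (ℕ.≤-trans lt (ℕ.≤-reflexive (sym W.len)))
    where
    module V = ShortWord (shortWord m≤n F)
    module W = ShortWord (shortWord m≤n H)

  ¬shorter : ∀ {f h} → Elem X n h → (∀ {as} → ∏ X as ≗ f → ℓ h ≤ length as) → ¬ Shorter X f h
  ¬shorter H bound (as , bs , R , T , lt) = ℕ.<⇒≱ lt
    (ℕ.≤-trans (ℕ.≤-reflexive (reduced⇒length H _ {bs} T)) (bound {as} (IsReducedWord.product R)))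

  ¬shorterʳ : ∀ {f} → Elem X n f → ∀ g → (GenOfRank n g → ℓ f ≤ ℓ (f ∘ gen X g)) →
              ¬ Shorter X (f ∘ gen X g) f
  ¬shorterʳ F g asc with rank? n g
  ... | yes pg = ¬shorter F λ {as} eq → ℕ.≤-trans (asc pg) (inv≤length m≤n (elem-gen m≤n F g pg) {as} eq)
  ... | no ¬pg = ¬shorter F λ {as} → outsideʳ m≤n F ¬pg {as}

  ¬shorterˡ : ∀ {f} → Elem X n f → ∀ g → (GenOfRank n g → ℓ f ≤ ℓ (gen X g ∘ f)) →
              ¬ Shorter X (gen X g ∘ f) f
  ¬shorterˡ F g asc with rank? n g
  ... | yes pg = ¬shorter F λ {as} eq → ℕ.≤-trans (asc pg) (inv≤length m≤n (elem-∘ m≤n F g pg) {as} eq)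
  ... | no ¬pg = ¬shorter F λ {as} → outsideˡ m≤n F ¬pg {as}

-- Polynomials and substitutions

module Ring (V : Set) where
  open CommutativeRing (polyRing V) public
    using (ring; commutativeSemiring; setoid; +-identityʳ; *-identityʳ;
           zeroˡ; zeroʳ; distribˡ; -‿inverseʳ)
  open RingProperties ring public using (-‿distribˡ-*; -‿involutive; -‿+-comm; -0#≈0#)
  open SetoidReasoning setoid public
  open Solver commutativeSemiring public using (solve; _:+_; _:*_; _:=_)

≡⇒≈ : ∀ {V} {f g : Poly V} → f ≡ g → f ≈ g
≡⇒≈ refl = ≈-refl

-- The recurrence gives u f′ = u f - d h = u (f + c h). Only `u`, which will be the scale 1 or 2, is
-- cancelled, by means of its inverse `r`.
quotient⇒act : ∀ {V} {r u c d f f′ h : Poly V} → r * u ≈ con 1ℚ → u * c ≈ - d →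
  d * h ≈ u * (f - f′) → f′ ≈ f + c * h
quotient⇒act {V} {r} {u} {c} {d} {f} {f′} {h} ru≈1 uc≈-d dh≈ = begin
  f′                           ≈⟨ cancel f′ ⟩
  r * (u * f′)                 ≈⟨ *-cong ≈-refl uf′ ⟩
  r * (u * (f + c * h))        ≈⟨ cancel _ ⟨
  f + c * h                    ∎
  where
  open Ring V
  cancel : ∀ a → a ≈ r * (u * a)
  cancel a = begin
    a              ≈⟨ *-idˡ a ⟨
    con 1ℚ * a     ≈⟨ *-cong ru≈1 ≈-refl ⟨
    (r * u) * a    ≈⟨ *-assoc r u a ⟩
    r * (u * a)    ∎
  uch : u * (c * h) ≈ - (d * h)
  uch = begin
    u * (c * h)    ≈⟨ *-assoc u c h ⟨
    (u * c) * h    ≈⟨ *-cong uc≈-d ≈-refl ⟩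
    (- d) * h      ≈⟨ -‿distribˡ-* d h ⟨
    - (d * h)      ∎
  uf′ : u * f′ ≈ u * (f + c * h)
  uf′ = begin
    u * f′                                ≈⟨ +-identityʳ _ ⟨
    u * f′ + con 0ℚ                       ≈⟨ +-cong ≈-refl (-‿inverseʳ (d * h)) ⟨
    u * f′ + (d * h + - (d * h))          ≈⟨ +-cong ≈-refl (+-cong dh≈ (≈-sym uch)) ⟩
    u * f′ + (u * (f + - f′) + u * (c * h))
      ≈⟨ solve 5 (λ u a b b′ e → u :* b :+ (u :* (a :+ b′) :+ u :* e)
                              := u :* (a :+ e) :+ u :* (b :+ b′)) ≈-refl u f f′ (- f′) (c * h) ⟩
    u * (f + c * h) + u * (f′ + - f′)     ≈⟨ +-cong ≈-refl (*-cong ≈-refl (-‿inverseʳ f′)) ⟩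
    u * (f + c * h) + u * con 0ℚ          ≈⟨ +-cong ≈-refl (zeroʳ u) ⟩
    u * (f + c * h) + con 0ℚ              ≈⟨ +-identityʳ _ ⟩
    u * (f + c * h)                       ∎

quotient-0⇒fixed : ∀ {V} {r u c d f f′ : Poly V} → r * u ≈ con 1ℚ → u * c ≈ - d →
  d * con 0ℚ ≈ u * (f - f′) → f′ ≈ f
quotient-0⇒fixed {V} ru≈1 uc≈-d d0≈ = ≈-trans (quotient⇒act ru≈1 uc≈-d d0≈)
  (≈-trans (+-cong ≈-refl (zeroʳ _)) (+-identityʳ _))
  where open Ring V

subst-resp-≈ : ∀ {V W} (σ : V → Poly W) {f g} → f ≈ g → subst σ f ≈ subst σ g
subst-resp-≈ σ ≈-refl           = ≈-refl
subst-resp-≈ σ (≈-sym e)        = ≈-sym (subst-resp-≈ σ e)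
subst-resp-≈ σ (≈-trans e e′)   = ≈-trans (subst-resp-≈ σ e) (subst-resp-≈ σ e′)
subst-resp-≈ σ (+-cong e e′)    = +-cong (subst-resp-≈ σ e) (subst-resp-≈ σ e′)
subst-resp-≈ σ (*-cong e e′)    = *-cong (subst-resp-≈ σ e) (subst-resp-≈ σ e′)
subst-resp-≈ σ (-‿cong e)       = -‿cong (subst-resp-≈ σ e)
subst-resp-≈ σ (+-assoc f g h)  = +-assoc _ _ _
subst-resp-≈ σ (+-comm f g)     = +-comm _ _
subst-resp-≈ σ (+-idˡ f)        = +-idˡ _
subst-resp-≈ σ (-‿invˡ f)       = -‿invˡ _
subst-resp-≈ σ (*-assoc f g h)  = *-assoc _ _ _
subst-resp-≈ σ (*-comm f g)     = *-comm _ _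
subst-resp-≈ σ (*-idˡ f)        = *-idˡ _
subst-resp-≈ σ (distribʳ f g h) = distribʳ _ _ _
subst-resp-≈ σ (con-+ a b)      = con-+ a b
subst-resp-≈ σ (con-* a b)      = con-* a b

subst-cong : ∀ {V W} {σ τ : V → Poly W} → (∀ v → σ v ≈ τ v) → ∀ f → subst σ f ≈ subst τ f
subst-cong e (con a) = ≈-refl
subst-cong e (var v) = e v
subst-cong e (f + g) = +-cong (subst-cong e f) (subst-cong e g)
subst-cong e (f * g) = *-cong (subst-cong e f) (subst-cong e g)
subst-cong e (- f)   = -‿cong (subst-cong e f)

subst-subst : ∀ {U V W} (σ : V → Poly W) (τ : U → Poly V) f →
  subst σ (subst τ f) ≡ subst (subst σ ∘ τ) f
subst-subst σ τ (con a) = refl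
subst-subst σ τ (var v) = refl
subst-subst σ τ (f + g) = cong₂ _+_ (subst-subst σ τ f) (subst-subst σ τ g)
subst-subst σ τ (f * g) = cong₂ _*_ (subst-subst σ τ f) (subst-subst σ τ g)
subst-subst σ τ (- f)   = cong -_ (subst-subst σ τ f)

subst-^ : ∀ {V W} (σ : V → Poly W) f n → subst σ (f ^ n) ≡ subst σ f ^ n
subst-^ σ f zero    = refl
subst-^ σ f (suc n) = cong (subst σ f *_) (subst-^ σ f n)

con-neg : ∀ {V} a → con {V} (ℚ.- a) ≈ - con a
con-neg {V} a = begin
  con (ℚ.- a)                        ≈⟨ +-identityʳ _ ⟨
  con (ℚ.- a) + con 0ℚ               ≈⟨ +-cong ≈-refl (-‿inverseʳ (con a)) ⟨
  con (ℚ.- a) + (con a + - con a)    ≈⟨ +-assoc _ _ _ ⟨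
  (con (ℚ.- a) + con a) + - con a    ≈⟨ +-cong (con-+ _ _) ≈-refl ⟨
  con (ℚ.- a ℚ.+ a) + - con a        ≈⟨ +-cong (≡⇒≈ (cong con (ℚ.+-inverseˡ a))) ≈-refl ⟩
  con 0ℚ + - con a                   ≈⟨ +-idˡ _ ⟩
  - con a                            ∎
  where open Ring V

subst-0 : ∀ {V W} (σ : V → Poly W) → (∀ v → σ v ≈ con 0ℚ) → ∀ f → subst σ f ≈ con (constantTerm f)
subst-0 σ σ0 (con a) = ≈-refl
subst-0 σ σ0 (var v) = σ0 v
subst-0 σ σ0 (f + g) = ≈-trans (+-cong (subst-0 σ σ0 f) (subst-0 σ σ0 g)) (≈-sym (con-+ _ _))
subst-0 σ σ0 (f * g) = ≈-trans (*-cong (subst-0 σ σ0 f) (subst-0 σ σ0 g)) (≈-sym (con-* _ _))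
subst-0 σ σ0 (- f)   = ≈-trans (-‿cong (subst-0 σ σ0 f)) (≈-sym (con-neg _))

-- Evaluation at points with a movable entry

insert : ∀ {A : Set} → ℕ → A → (ℕ → A) → ℕ → A
insert zero    a ζ zero    = a
insert zero    a ζ (suc i) = ζ i
insert (suc q) a ζ zero    = ζ 0
insert (suc q) a ζ (suc i) = insert q a (ζ ∘ suc) i

module _ {A : Set} (a : A) where

  -- The exchange at `q` carries the inserted entry one place further while the others keep their
  -- order. Every move of an entry through the variables is a chain of such exchanges.
  insert-swap : ∀ q ζ i → insert q a ζ (swap q i) ≡ insert (suc q) a ζ i
  insert-swap zero    ζ zero          = refl
  insert-swap zero    ζ (suc zero)    = refl
  insert-swap zero    ζ (suc (suc i)) = refl
  insert-swap (suc q) ζ zero          = refl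
  insert-swap (suc q) ζ (suc i)       = insert-swap q (ζ ∘ suc) i

  insert-at : ∀ q ζ → insert q a ζ q ≡ a
  insert-at zero    ζ = refl
  insert-at (suc q) ζ = insert-at q (ζ ∘ suc)

  insert-next : ∀ q ζ → insert q a ζ (suc q) ≡ ζ q
  insert-next zero    ζ = refl
  insert-next (suc q) ζ = insert-next q (ζ ∘ suc)

  insert-below : ∀ {q i} ζ → i < q → insert q a ζ i ≡ ζ i
  insert-below {suc q} {zero}  ζ _         = refl
  insert-below {suc q} {suc i} ζ (s≤s i<q) = insert-below (ζ ∘ suc) i<q

module _ {W : Set} where
  open Ring W

  -- The x-variables are a list whose power sums are the values of `p`, so adding a power of y to
  -- each power sum is the same as passing to `y ∷ xs`.
  point : (ζ τ : ℕ → Poly W) → List (Poly W) → Var → Poly W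
  point ζ τ xs (z i) = ζ i
  point ζ τ xs (t i) = τ i
  point ζ τ xs (p j) = ∑ xs (_^ odd# j)

  eval : (ζ τ : ℕ → Poly W) → List (Poly W) → 𝓡 → Poly W
  eval ζ τ xs = subst (point ζ τ xs)

  eval-swapᶻ : ∀ {ζ τ xs} i f → eval ζ τ xs (subst (swapᶻ i) f) ≈ eval (ζ ∘ swap i) τ xs f
  eval-swapᶻ i f = ≈-trans (≡⇒≈ (subst-subst _ _ f)) (subst-cong (λ where
    (z j) → ≈-refl
    (t j) → ≈-refl
    (p j) → ≈-refl) f)

  eval-swapᵗ : ∀ {ζ τ xs} i f → eval ζ τ xs (subst (swapᵗ i) f) ≈ eval ζ (τ ∘ swap i) xs f
  eval-swapᵗ i f = ≈-trans (≡⇒≈ (subst-subst _ _ f)) (subst-cong (λ where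
    (z j) → ≈-refl
    (t j) → ≈-refl
    (p j) → ≈-refl) f)

  eval-s₀ᶻ : ∀ {ζ τ xs} y f → eval (insert 0 y ζ) τ xs (subst s₀ᶻ f) ≈ eval (insert 0 (- y) ζ) τ (y ∷ xs) f
  eval-s₀ᶻ {ζ} {τ} {xs} y f = ≈-trans (≡⇒≈ (subst-subst _ _ f)) (subst-cong (λ where
    (z zero)    → ≈-refl
    (z (suc j)) → ≈-refl
    (t j)       → ≈-refl
    (p j)       → ≈-trans
      (+-cong ≈-refl (≡⇒≈ (subst-^ (point (insert 0 y ζ) τ xs) (var (z 0)) (odd# j))))
      (+-comm _ _)) f)

  -- With z = (y, 0, ...), s_1̂ sends z_1 to -0 and z_2 to -y, so the entry returns at position 1
  -- and not at 0. This is why the column of a type D block continues with index 2.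
  eval-s₁̂ᶻ : ∀ {ζ τ xs} y f → ζ 0 ≈ con 0ℚ →
    eval (insert 0 y ζ) τ xs (subst s₁̂ᶻ f) ≈ eval (insert 1 (- y) ζ) τ (y ∷ xs) f
  eval-s₁̂ᶻ {ζ} {τ} {xs} y f ζ0≈0 = ≈-trans (≡⇒≈ (subst-subst _ _ f)) (subst-cong (λ where
    (z zero)          → ≈-trans (-‿cong ζ0≈0) (≈-trans -0#≈0# (≈-sym ζ0≈0))
    (z (suc zero))    → ≈-refl
    (z (suc (suc j))) → ≈-refl
    (t j)             → ≈-refl
    (p j)             → begin
      subst σ (var (p j) + var (z 0) ^ odd# j + var (z 1) ^ odd# j)
        ≈⟨ +-cong (+-cong ≈-refl (≡⇒≈ (subst-^ σ (var (z 0)) (odd# j))))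
                 (≡⇒≈ (subst-^ σ (var (z 1)) (odd# j))) ⟩
      ∑ xs (_^ odd# j) + y ^ odd# j + ζ 0 ^ odd# j
        ≈⟨ +-cong (+-comm _ _) (≈-trans (*-cong ζ0≈0 ≈-refl) (zeroˡ _)) ⟩
      y ^ odd# j + ∑ xs (_^ odd# j) + con 0ℚ
        ≈⟨ +-identityʳ _ ⟩
      y ^ odd# j + ∑ xs (_^ odd# j) ∎) f)
    where σ = point (insert 0 y ζ) τ xs

  -- Read off the term and not its class under `≈`; any bound on the z- and t-indices that occur is
  -- good enough.
  support : 𝓡 → ℕ
  support (con a)     = 0
  support (var (z i)) = suc i
  support (var (t i)) = suc i
  support (var (p j)) = 0
  support (f + g)     = support f ⊔ support g
  support (f * g)     = support f ⊔ support g
  support (- f)       = support f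

  eval-local : ∀ {ζ ζ′ τ τ′ xs N} f → support f ≤ N →
    (∀ {i} → i < N → ζ i ≈ ζ′ i) → (∀ {i} → i < N → τ i ≈ τ′ i) →
    eval ζ τ xs f ≈ eval ζ′ τ′ xs f
  eval-local (con a)     le eᶻ eᵗ = ≈-refl
  eval-local (var (z i)) le eᶻ eᵗ = eᶻ le
  eval-local (var (t i)) le eᶻ eᵗ = eᵗ le
  eval-local (var (p j)) le eᶻ eᵗ = ≈-refl
  eval-local (f + g)     le eᶻ eᵗ = +-cong (eval-local f (ℕ.m⊔n≤o⇒m≤o _ _ le) eᶻ eᵗ)
                                           (eval-local g (ℕ.m⊔n≤o⇒n≤o (support f) _ le) eᶻ eᵗ)
  eval-local (f * g)     le eᶻ eᵗ = *-cong (eval-local f (ℕ.m⊔n≤o⇒m≤o _ _ le) eᶻ eᵗ)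
                                           (eval-local g (ℕ.m⊔n≤o⇒n≤o (support f) _ le) eᶻ eᵗ)
  eval-local (- f)       le eᶻ eᵗ = -‿cong (eval-local f le eᶻ eᵗ)

-- Minus the denominator over the scale, so that s_g f = f + cᶻ · ∂f.
cᶻ : LieType → Gen → 𝓡
cᶻ X (s i) = var (z (suc i)) - var (z i)
cᶻ B s̃ = var (z 0)
cᶻ C s̃ = 2# * var (z 0)
cᶻ D s̃ = var (z 0) + var (z 1)

scaleInverse : LieType → Gen → 𝓡
scaleInverse B s̃ = con ½
scaleInverse X g = con 1ℚ

scaleInverse-inverse : ∀ X g → scaleInverse X g * scale X g ≈ con 1ℚ
scaleInverse-inverse B s̃     = ≈-sym (con-* ½ _)
scaleInverse-inverse C s̃     = *-idˡ _
scaleInverse-inverse D s̃     = *-idˡ _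
scaleInverse-inverse B (s i) = *-idˡ _
scaleInverse-inverse C (s i) = *-idˡ _
scaleInverse-inverse D (s i) = *-idˡ _

private
  scale-s : ∀ X i → scale X (s i) ≡ con 1ℚ
  scale-s B i = refl
  scale-s C i = refl
  scale-s D i = refl

neg-sub : ∀ {V} (f g : Poly V) → f - g ≈ - (g - f)
neg-sub {V} f g = begin
  f + - g           ≈⟨ +-comm _ _ ⟩
  - g + f           ≈⟨ +-cong ≈-refl (-‿involutive f) ⟨
  - g + - - f       ≈⟨ -‿+-comm g (- f) ⟩
  - (g + - f)       ∎
  where open Ring V

scale-cᶻ : ∀ X g → scale X g * cᶻ X g ≈ - denᶻ X g
scale-cᶻ X (s i) = ≈-trans (*-cong (≡⇒≈ (scale-s X i)) ≈-refl) (≈-trans (*-idˡ _) (neg-sub _ _))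
scale-cᶻ B s̃ = ≈-sym (Ring.-‿involutive Var _)
scale-cᶻ C s̃ = ≈-trans (*-idˡ _) (≈-sym (Ring.-‿involutive Var _))
scale-cᶻ D s̃ = begin
  con 1ℚ * (var (z 0) + var (z 1))   ≈⟨ *-idˡ _ ⟩
  var (z 0) + var (z 1)              ≈⟨ -‿involutive _ ⟨
  - - (var (z 0) + var (z 1))        ≈⟨ -‿cong (-‿+-comm _ _) ⟨
  - (- var (z 0) - var (z 1))        ∎
  where open Ring Var

scale-cᵗ : ∀ X i → scale X (s i) * (var (t i) - var (t (suc i))) ≈ - denᵗ X (s i)
scale-cᵗ X i = ≈-trans (*-cong (≡⇒≈ (scale-s X i)) ≈-refl) (≈-trans (*-idˡ _) (neg-sub _ _))

module _ {A V : Set} where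
  open Ring V

  ∑-cong : ∀ as {f g : A → Poly V} → (∀ a → f a ≈ g a) → ∑ as f ≈ ∑ as g
  ∑-cong []       e = ≈-refl
  ∑-cong (a ∷ as) e = +-cong (e a) (∑-cong as e)

  ∑-linear : ∀ as {f g : A → Poly V} c → ∑ as (λ a → f a + c * g a) ≈ ∑ as f + c * ∑ as g
  ∑-linear []       c = ≈-sym (≈-trans (+-idˡ _) (zeroʳ c))
  ∑-linear (a ∷ as) {f} {g} c = begin
    (f a + c * g a) + ∑ as (λ a → f a + c * g a)    ≈⟨ +-cong ≈-refl (∑-linear as c) ⟩
    (f a + c * g a) + (∑ as f + c * ∑ as g)
      ≈⟨ solve 5 (λ a c b u v → (a :+ c :* b) :+ (u :+ c :* v) := (a :+ u) :+ c :* (b :+ v))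
           ≈-refl (f a) c (g a) (∑ as f) (∑ as g) ⟩
    (f a + ∑ as f) + c * (g a + ∑ as g)             ∎

  ∑-++ : ∀ as {bs} {f : A → Poly V} → ∑ (as ++ bs) f ≈ ∑ as f + ∑ bs f
  ∑-++ []       = ≈-sym (+-idˡ _)
  ∑-++ (a ∷ as) = ≈-trans (+-cong ≈-refl (∑-++ as)) (≈-sym (+-assoc _ _ _))

  ∑-distribˡ : ∀ as {f : A → Poly V} c → ∑ as (λ a → c * f a) ≈ c * ∑ as f
  ∑-distribˡ []       c = ≈-sym (zeroʳ c)
  ∑-distribˡ (a ∷ as) c = ≈-trans (+-cong ≈-refl (∑-distribˡ as c)) (≈-sym (distribˡ c _ _))

  ∑-map : ∀ {B : Set} (h : B → A) bs {f : A → Poly V} → ∑ (map h bs) f ≡ ∑ bs (f ∘ h)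
  ∑-map h []           = refl
  ∑-map h (b ∷ bs) {f} = cong (f (h b) +_) (∑-map h bs)

-- Sums over fillings

tiles : ∀ ι → List (Tile ι)
tiles 0′    = elbow ∷ elbowFaucet ∷ []
tiles 1′    = elbow ∷ cross′ ∷ crossFaucet ∷ elbowFaucets ∷ []
tiles (# i) = elbow ∷ cross ∷ []

module _ {k : ℕ} where
  open Ring (TruncVar k)
  open Box

  private
    R = Poly (TruncVar k)

  -- The sum over all fillings T of F (word T) times the monomial of T.
  tileSum : List (Box k) → (List Gen → R) → R
  tileSum []       F = F []
  tileSum (b ∷ bs) F = ∑ (tiles (index b)) λ a →
    variable′ b ^ weight a * tileSum bs λ u → F (letters a ++ u)

  tileSum-cong : ∀ bs {F G} → (∀ u → F u ≈ G u) → tileSum bs F ≈ tileSum bs G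
  tileSum-cong []       e = e []
  tileSum-cong (b ∷ bs) e = ∑-cong (tiles (index b)) λ a → *-cong ≈-refl (tileSum-cong bs λ u → e _)

  tileSum-linear : ∀ bs {F G} c → tileSum bs (λ u → F u + c * G u) ≈ tileSum bs F + c * tileSum bs G
  tileSum-linear []       c = ≈-refl
  tileSum-linear (b ∷ bs) {F} {G} c = ≈-trans
    (∑-cong (tiles (index b)) λ a → ≈-trans (*-cong ≈-refl (tileSum-linear bs c))
      (solve 4 (λ m a c b → m :* (a :+ c :* b) := m :* a :+ c :* (m :* b)) ≈-refl
        (variable′ b ^ weight a) (tileSum bs λ u → F (letters a ++ u)) c (tileSum bs λ u → G (letters a ++ u))))
    (∑-linear (tiles (index b)) c)

  tileSum-0 : ∀ bs → tileSum bs (λ _ → con 0ℚ) ≈ con 0ℚ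
  tileSum-0 []       = ≈-refl
  tileSum-0 (b ∷ bs) = ≈-trans
    (∑-cong (tiles (index b)) {g = λ _ → con 0ℚ * con 0ℚ} λ a →
      ≈-trans (*-cong ≈-refl (tileSum-0 bs)) (≈-trans (zeroʳ _) (≈-sym (zeroˡ _))))
    (≈-trans (∑-distribˡ (tiles (index b)) (con 0ℚ)) (zeroˡ _))

  tileSum-++ : ∀ as bs {F} → tileSum (as ++ bs) F ≈ tileSum as (λ u → tileSum bs λ v → F (u ++ v))
  tileSum-++ []       bs = ≈-refl
  tileSum-++ (a ∷ as) bs {F} = ∑-cong (tiles (index a)) λ e → *-cong ≈-refl
    (≈-trans (tileSum-++ as bs) (tileSum-cong as λ u → tileSum-cong bs λ v →
      ≡⇒≈ (cong F (sym (List.++-assoc (letters e) u v)))))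

  -- The box acts as the factor 1 + c u_g, where c is its variable.
  record SplitsAs (b : Box k) (g : Gen) : Set where
    constructor splitsAs
    field
      split : ∀ bs F → tileSum (b ∷ bs) F ≈ tileSum bs F + variable′ b * tileSum bs λ u → F (g ∷ u)

  open SplitsAs public

  private
    two-terms : ∀ c f g → c ^ 0 * f + (c ^ 1 * g + con 0ℚ) ≈ f + c * g
    two-terms c f g = +-cong (*-idˡ f) (≈-trans (+-identityʳ _) (*-cong (*-identityʳ c) ≈-refl))

  cross-splits : ∀ i c → SplitsAs (box (# i) c) (s i)
  cross-splits i c = splitsAs λ bs F → two-terms c _ _

  faucet-splits : ∀ c → SplitsAs (box 0′ c) s̃
  faucet-splits c = splitsAs λ bs F → two-terms c _ _

  -- A box 1′ amounts to a box with letter s₁ followed by a box with letter s_1̂.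
  tileSum-1′ : ∀ c bs F → tileSum (box 1′ c ∷ bs) F ≈ tileSum (box (# 0) c ∷ box 0′ c ∷ bs) F
  tileSum-1′ c bs F = begin
    c ^ 0 * a + (c ^ 1 * b + (c ^ 1 * u + (c ^ 2 * v + con 0ℚ)))
      ≈⟨ +-cong (*-idˡ a) (+-cong (*-cong c¹ ≈-refl) (+-cong (*-cong c¹ ≈-refl)
           (≈-trans (+-identityʳ _) (*-cong (*-cong ≈-refl c¹) ≈-refl)))) ⟩
    a + (c * b + (c * u + (c * c) * v))
      ≈⟨ solve 5 (λ c a b u v → a :+ (c :* b :+ (c :* u :+ (c :* c) :* v)) := (a :+ c :* u) :+ c :* (b :+ c :* v))
           ≈-refl c a b u v ⟩
    (a + c * u) + c * (b + c * v)
      ≈⟨ +-cong (split (faucet-splits c) bs F) (*-cong ≈-refl (split (faucet-splits c) bs λ w → F (s 0 ∷ w))) ⟨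
    tileSum (box 0′ c ∷ bs) F + c * tileSum (box 0′ c ∷ bs) (λ w → F (s 0 ∷ w))
      ≈⟨ split (cross-splits 0 c) (box 0′ c ∷ bs) F ⟨
    tileSum (box (# 0) c ∷ box 0′ c ∷ bs) F ∎
    where
    c¹ : c ^ 1 ≈ c
    c¹ = *-identityʳ c
    a = tileSum bs F
    b = tileSum bs λ w → F (s 0 ∷ w)
    u = tileSum bs λ w → F (s̃ ∷ w)
    v = tileSum bs λ w → F (s 0 ∷ s̃ ∷ w)

-- The nilCoxeter action and the boxes as factors

module Operators (X : LieType) (n : ℕ) (m≤n : minRank X ≤ n) where
  open Parabolic X n m≤n public

  𝟙 : ∀ {V} → Bool → Poly V
  𝟙 b = if b then con 1ℚ else con 0ℚ

  Descentʳ Descentˡ : Gen → 𝔽 → Set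
  Descentʳ g w = ℓ (fun w ∘ gen X g) < ℓ (fun w)
  Descentˡ g w = ℓ (gen X g ∘ fun w) < ℓ (fun w)

  -- E acted on by 1 + c u_g in the nilCoxeter algebra, from the right and
  -- from the left.
  actʳ actˡ : ∀ {V} g → GenOfRank n g → Poly V → (𝔽 → Poly V) → 𝔽 → Poly V
  actʳ g pg c E w with ℓ (fun w ∘ gen X g) ℕ.<? ℓ (fun w)
  ... | yes _ = E w + c * E (mulʳ w g pg)
  ... | no _  = E w
  actˡ g pg c E w with ℓ (gen X g ∘ fun w) ℕ.<? ℓ (fun w)
  ... | yes _ = E w + c * E (mulˡ g pg w)
  ... | no _  = E w

  actʳ-cong : ∀ {V g pg} {c c′ : Poly V} {E E′} → c ≈ c′ → (∀ w → E w ≈ E′ w) →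
              ∀ w → actʳ g pg c E w ≈ actʳ g pg c′ E′ w
  actʳ-cong {g = g} e e′ w with ℓ (fun w ∘ gen X g) ℕ.<? ℓ (fun w)
  ... | yes _ = +-cong (e′ w) (*-cong e (e′ _))
  ... | no _  = e′ w

  actˡ-cong : ∀ {V g pg} {c c′ : Poly V} {E E′} → c ≈ c′ → (∀ w → E w ≈ E′ w) →
              ∀ w → actˡ g pg c E w ≈ actˡ g pg c′ E′ w
  actˡ-cong {g = g} e e′ w with ℓ (gen X g ∘ fun w) ℕ.<? ℓ (fun w)
  ... | yes _ = +-cong (e′ w) (*-cong e (e′ _))
  ... | no _  = e′ w

  subst-actʳ : ∀ {V W g pg} (σ : V → Poly W) {c E} w →
    subst σ (actʳ g pg c E w) ≡ actʳ g pg (subst σ c) (subst σ ∘ E) w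
  subst-actʳ {g = g} σ w with ℓ (fun w ∘ gen X g) ℕ.<? ℓ (fun w)
  ... | yes _ = refl
  ... | no _  = refl

  subst-actˡ : ∀ {V W g pg} (σ : V → Poly W) {c E} w →
    subst σ (actˡ g pg c E w) ≡ actˡ g pg (subst σ c) (subst σ ∘ E) w
  subst-actˡ {g = g} σ w with ℓ (gen X g ∘ fun w) ℕ.<? ℓ (fun w)
  ... | yes _ = refl
  ... | no _  = refl

  -- (1 + c u_g)² = 1 + 2c u_g because u_g² = 0: if `g` is a descent of `w`, it is not one of w s_g.
  actʳ-double : ∀ {V g pg} (c : Poly V) E w →
    actʳ g pg c (actʳ g pg c E) w ≈ actʳ g pg (c + c) E w
  actʳ-double {V} {g} {pg} c E w with ℓ (fun w ∘ gen X g) ℕ.<? ℓ (fun w)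
  ... | no ≮ with ℓ (fun w ∘ gen X g) ℕ.<? ℓ (fun w)
  ...   | yes lt = contradiction lt ≮
  ...   | no _ = ≈-refl
  actʳ-double {V} {g} {pg} c E w | yes lt
    with ℓ (fun w ∘ gen X g) ℕ.<? ℓ (fun w) | ℓ (fun w ∘ gen X g ∘ gen X g) ℕ.<? ℓ (fun w ∘ gen X g)
  ... | no ≮ | _ = contradiction lt ≮
  ... | yes _ | yes lt′ = contradiction
          (ℕ.≤-<-trans (ℕ.≤-reflexive (inv-cong X n λ a → cong (fun w) (sym (gen-involutive X g a)))) lt′)
          (ℕ.<⇒≯ lt)
  ... | yes _ | no _ = ≈-trans (+-assoc _ _ _) (+-cong ≈-refl (≈-sym (distribʳ _ _ _)))

  module _ {k : ℕ} where
    open Ring (TruncVar k)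

    -- The coefficient of u_w in the nilCoxeter product of the letters of `u`.
    χ : 𝔽 → List Gen → Poly (TruncVar k)
    χ w u = 𝟙 (does (red? u (elem w)))

    χ-snoc : ∀ {w g} pg u → Descentʳ g w → χ w (u ++ [ g ]) ≡ χ (mulʳ w g pg) u
    χ-snoc {w} {g} pg u lt = cong 𝟙 (does-⇔
      (mk⇔ (proj₂ ∘ red-unsnoc (elem w) {g} {u} pg) (red-snoc (elem w) pg lt))
      (red? (u ++ [ g ]) (elem w)) (red? u (elem (mulʳ w g pg))))

    χ-snoc-0 : ∀ {w g} → GenOfRank n g → ∀ u → ¬ Descentʳ g w → χ w (u ++ [ g ]) ≡ con 0ℚ
    χ-snoc-0 {w} {g} pg u ≮ = cong 𝟙 (dec-false (red? (u ++ [ g ]) (elem w))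
      (≮ ∘ proj₁ ∘ red-unsnoc (elem w) {g} {u} pg))

    χ-cons : ∀ {w g} pg u → Descentˡ g w → χ w (g ∷ u) ≡ χ (mulˡ g pg w) u
    χ-cons {w} {g} pg u lt = cong 𝟙 (does-⇔
      (mk⇔ (proj₂ ∘ proj₂ ∘ red-uncons (elem w) {g} {u}) (red-cons (elem w) pg lt))
      (red? (g ∷ u) (elem w)) (red? u (elem (mulˡ g pg w))))

    χ-cons-0 : ∀ {w g} u → ¬ Descentˡ g w → χ w (g ∷ u) ≡ con 0ℚ
    χ-cons-0 {w} {g} u ≮ = cong 𝟙 (dec-false (red? (g ∷ u) (elem w))
      (≮ ∘ proj₁ ∘ proj₂ ∘ red-uncons (elem w) {g} {u}))

    infix 3 _Represents_
    -- The product of the factors of the boxes, in reading order, equals Σ_w E(w) u_w.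
    record _Represents_ (bs : List (Box k)) (E : 𝔽 → Poly (TruncVar k)) : Set where
      constructor represents
      field
        tileSum≈ : ∀ w → tileSum bs (χ w) ≈ E w

    open _Represents_ public

    represents-resp : ∀ {bs E E′} → (∀ w → E′ w ≈ E w) → bs Represents E → bs Represents E′
    represents-resp e r = represents λ w → ≈-trans (tileSum≈ r w) (≈-sym (e w))

    -- The letter `g` of the last box contributes only if it is a right descent of `w`; cutting it
    -- off then leaves the reduced words of w s_g.
    represents-snoc : ∀ {bs b g E} → SplitsAs b g → (pg : GenOfRank n g) → bs Represents E →
      bs ++ [ b ] Represents actʳ g pg (Box.variable′ b) E
    represents-snoc {bs} {b} {g} {E} sp pg r = represents λ w → ≈-trans
      (begin
        tileSum (bs ++ [ b ]) (χ w)                                ≈⟨ tileSum-++ bs [ b ] ⟩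
        tileSum bs (λ u → tileSum [ b ] λ v → χ w (u ++ v))
          ≈⟨ tileSum-cong bs (λ u → split sp [] λ v → χ w (u ++ v)) ⟩
        tileSum bs (λ u → χ w (u ++ []) + c * χ w (u ++ [ g ]))
          ≈⟨ tileSum-cong bs (λ u → +-cong (≡⇒≈ (cong (χ w) (List.++-identityʳ u))) ≈-refl) ⟩
        tileSum bs (λ u → χ w u + c * χ w (u ++ [ g ]))            ≈⟨ tileSum-linear bs c ⟩
        tileSum bs (χ w) + c * tileSum bs (λ u → χ w (u ++ [ g ])) ≈⟨ +-cong (tileSum≈ r w) ≈-refl ⟩
        E w + c * tileSum bs (λ u → χ w (u ++ [ g ]))              ∎)
      (last w)
      where
      c = Box.variable′ b
      last : ∀ w → E w + c * tileSum bs (λ u → χ w (u ++ [ g ])) ≈ actʳ g pg c E w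
      last w with ℓ (fun w ∘ gen X g) ℕ.<? ℓ (fun w)
      ... | yes lt = +-cong ≈-refl (*-cong ≈-refl
              (≈-trans (tileSum-cong bs λ u → ≡⇒≈ (χ-snoc {w} pg u lt)) (tileSum≈ r (mulʳ w g pg))))
      ... | no ≮ = ≈-trans (+-cong ≈-refl (≈-trans (*-cong ≈-refl
              (≈-trans (tileSum-cong bs λ u → ≡⇒≈ (χ-snoc-0 {w} pg u ≮)) (tileSum-0 bs))) (zeroʳ c)))
              (+-identityʳ _)

    represents-cons : ∀ {bs b g E} → SplitsAs b g → (pg : GenOfRank n g) → bs Represents E →
      b ∷ bs Represents actˡ g pg (Box.variable′ b) E
    represents-cons {bs} {b} {g} {E} sp pg r = represents λ w →
      ≈-trans (split sp bs (χ w)) (≈-trans (+-cong (tileSum≈ r w) ≈-refl) (last w))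
      where
      c = Box.variable′ b
      last : ∀ w → E w + c * tileSum bs (λ u → χ w (g ∷ u)) ≈ actˡ g pg c E w
      last w with ℓ (gen X g ∘ fun w) ℕ.<? ℓ (fun w)
      ... | yes lt = +-cong ≈-refl (*-cong ≈-refl
              (≈-trans (tileSum-cong bs λ u → ≡⇒≈ (χ-cons {w} {g} pg u lt)) (tileSum≈ r (mulˡ g pg w))))
      ... | no ≮ = ≈-trans (+-cong ≈-refl (≈-trans (*-cong ≈-refl
              (≈-trans (tileSum-cong bs λ u → ≡⇒≈ (χ-cons-0 {w} {g} u ≮)) (tileSum-0 bs))) (zeroʳ c)))
              (+-identityʳ _)

    represents-1′ : ∀ {bs c E} → bs ++ box (# 0) c ∷ [ box 0′ c ] Represents E → bs ++ [ box 1′ c ] Represents E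
    represents-1′ {bs} {c} r = represents λ w → ≈-trans (tileSum-++ bs _) (≈-trans
      (tileSum-cong bs λ u → tileSum-1′ c [] λ v → χ w (u ++ v)) (≈-trans (≈-sym (tileSum-++ bs _)) (tileSum≈ r w)))

module _ {A : Set} (Q : ℕ → List A → Set) where

  -- `Q j as` is a loop invariant: `as` holds the boxes so far, and `j` is the position of a moving
  -- entry or the number of a row. Along `downFrom` the index falls when boxes are appended and
  -- rises when they are prepended.
  downFrom-snoc : ∀ (f : ℕ → A) m {as} → (∀ {j} → j < m → ∀ {as} → Q (suc j) as → Q j (as ++ [ f j ])) →
    Q m as → Q 0 (as ++ map f (downFrom m))
  downFrom-snoc f zero    {as} step q = ≡.subst (Q 0) (sym (List.++-identityʳ as)) q
  downFrom-snoc f (suc m) {as} step q = ≡.subst (Q 0) (List.++-assoc as [ f m ] _)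
    (downFrom-snoc f m (step ∘ ℕ.m<n⇒m<1+n) (step (ℕ.n<1+n m) q))

  downFrom-cons : ∀ (f : ℕ → A) m {as} → (∀ {j} → j < m → ∀ {as} → Q j as → Q (suc j) (f j ∷ as)) →
    Q 0 as → Q m (map f (downFrom m) ++ as)
  downFrom-cons f zero    step q = q
  downFrom-cons f (suc m) step q = step (ℕ.n<1+n m) (downFrom-cons f m (step ∘ ℕ.m<n⇒m<1+n) q)

  concatMap-snoc : ∀ (r : ℕ → List A) m {as} → (∀ {j} → j < m → ∀ {as} → Q j as → Q (suc j) (as ++ r j)) →
    Q 0 as → Q m (as ++ concatMap r (upTo m))
  concatMap-snoc r zero    {as} step q = ≡.subst (Q 0) (sym (List.++-identityʳ as)) q
  concatMap-snoc r (suc m) {as} step q = ≡.subst (Q (suc m)) (begin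
      (as ++ concatMap r (upTo m)) ++ r m       ≡⟨ List.++-assoc as _ _ ⟩
      as ++ (concatMap r (upTo m) ++ r m)
        ≡⟨ cong (λ bs → as ++ concatMap r (upTo m) ++ bs) (List.++-identityʳ (r m)) ⟨
      as ++ (concatMap r (upTo m) ++ concatMap r [ m ])
        ≡⟨ cong (as ++_) (List.concatMap-++ r (upTo m) [ m ]) ⟨
      as ++ concatMap r (upTo m ∷ʳ m)           ≡⟨ cong (λ js → as ++ concatMap r js) (List.upTo-∷ʳ m) ⟩
      as ++ concatMap r (upTo (suc m))          ∎)
    (step (ℕ.n<1+n m) (concatMap-snoc r m (step ∘ ℕ.m<n⇒m<1+n) q))
    where open ≡-Reasoning

  concatMap-cons : ∀ (r : ℕ → List A) m {as} → (∀ {j} → j < m → ∀ {as} → Q (suc j) as → Q j (r j ++ as)) →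
    Q m as → Q 0 (concatMap r (upTo m) ++ as)
  concatMap-cons r zero    step q = q
  concatMap-cons r (suc m) {as} step q = ≡.subst (Q 0) (begin
      concatMap r (upTo m) ++ (r m ++ as)       ≡⟨ List.++-assoc (concatMap r (upTo m)) (r m) as ⟨
      (concatMap r (upTo m) ++ r m) ++ as
        ≡⟨ cong (λ bs → (concatMap r (upTo m) ++ bs) ++ as) (List.++-identityʳ (r m)) ⟨
      (concatMap r (upTo m) ++ concatMap r [ m ]) ++ as
        ≡⟨ cong (_++ as) (List.concatMap-++ r (upTo m) [ m ]) ⟨
      concatMap r (upTo m ∷ʳ m) ++ as           ≡⟨ cong (λ js → concatMap r js ++ as) (List.upTo-∷ʳ m) ⟩
      concatMap r (upTo (suc m)) ++ as          ∎)
    (concatMap-cons r m (step ∘ ℕ.m<n⇒m<1+n) (step (ℕ.n<1+n m) q))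
    where open ≡-Reasoning

  upTo-snoc : ∀ (f : ℕ → A) m {as} → (∀ {j} → j < m → ∀ {as} → Q j as → Q (suc j) (as ++ [ f j ])) →
    Q 0 as → Q m (as ++ map f (upTo m))
  upTo-snoc f m {as} step q = ≡.subst (λ bs → Q m (as ++ bs))
    (trans (cong concat (List.map-∘ (upTo m))) (List.concat-map-[_] (map f (upTo m))))
    (concatMap-snoc ([_] ∘ f) m step q)

-- Evaluations of double Schubert polynomials

-- The z-values represented once the first `i` rows of the lower staircase are present.
cut : ∀ {V} → ℕ → (ℕ → Poly V) → ℕ → Poly V
cut zero    ζ j       = con 0ℚ
cut (suc i) ζ zero    = ζ 0
cut (suc i) ζ (suc j) = cut i (ζ ∘ suc) j

cut-insert : ∀ {V} i (ζ : ℕ → Poly V) → insert i (ζ i) (cut i ζ) ≗ cut (suc i) ζ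
cut-insert zero    ζ zero    = refl
cut-insert zero    ζ (suc j) = refl
cut-insert (suc i) ζ zero    = refl
cut-insert (suc i) ζ (suc j) = cut-insert i (ζ ∘ suc) j

cut-above : ∀ {V} i j (ζ : ℕ → Poly V) → cut i ζ (i ℕ.+ j) ≡ con 0ℚ
cut-above zero    j ζ = refl
cut-above (suc i) j ζ = cut-above i j (ζ ∘ suc)

cut-below : ∀ {V i j} (ζ : ℕ → Poly V) → j < i → cut i ζ j ≡ ζ j
cut-below {i = suc i} {zero}  ζ _         = refl
cut-below {i = suc i} {suc j} ζ (s≤s j<i) = cut-below (ζ ∘ suc) j<i

-- The t-values represented when only the rows from `i` on (counted from 0) of the upper staircase
-- are present.
pad : ∀ {V} → ℕ → (ℕ → Poly V) → ℕ → Poly V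
pad zero    τ j       = τ j
pad (suc i) τ zero    = con 0ℚ
pad (suc i) τ (suc j) = pad i τ j

pad-insert : ∀ {V} i (τ : ℕ → Poly V) → insert i (con 0ℚ) (pad i τ) ≗ pad (suc i) τ
pad-insert zero    τ zero    = refl
pad-insert zero    τ (suc j) = refl
pad-insert (suc i) τ zero    = refl
pad-insert (suc i) τ (suc j) = pad-insert i τ j

pad-above : ∀ {V} i j (τ : ℕ → Poly V) → pad i τ (i ℕ.+ j) ≡ τ j
pad-above zero    j τ = refl
pad-above (suc i) j τ = pad-above i j τ

pad-below : ∀ {V i j} (τ : ℕ → Poly V) → j < i → pad i τ j ≡ con 0ℚ
pad-below {i = suc i} {zero}  τ _         = refl
pad-below {i = suc i} {suc j} τ (s≤s j<i) = pad-below τ j<i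

module Evaluation (X : LieType) (n : ℕ) (m≤n : minRank X ≤ n)
                  (𝔉 : Group∞ X → 𝓡) (isDS : IsDoubleSchubert X 𝔉) (k : ℕ) where
  open Operators X n m≤n public
  open IsDoubleSchubert isDS
  open Ring (TruncVar k)

  private
    R = Poly (TruncVar k)

  𝔉ₙ : 𝔽 → 𝓡
  𝔉ₙ w = 𝔉 (group∞ w)

  actᶻ-𝔉 : ∀ g pg w → actᶻ X g (𝔉ₙ w) ≈ actʳ g pg (cᶻ X g) 𝔉ₙ w
  actᶻ-𝔉 g pg w with ℓ (fun w ∘ gen X g) ℕ.<? ℓ (fun w)
  ... | yes lt = quotient⇒act (scaleInverse-inverse X g) (scale-cᶻ X g)
          (∂-desc g (group∞ w) (group∞ (mulʳ w g pg)) (λ _ → refl)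
            (length<⇒shorter (elem (mulʳ w g pg)) (elem w) lt))
  ... | no ≮ = quotient-0⇒fixed (scaleInverse-inverse X g) (scale-cᶻ X g)
          (∂-asc g (group∞ w) (¬shorterʳ (elem w) g λ _ → ℕ.≮⇒≥ ≮))

  actᶻ-outside : ∀ g → ¬ GenOfRank n g → ∀ w → actᶻ X g (𝔉ₙ w) ≈ 𝔉ₙ w
  actᶻ-outside g out w = quotient-0⇒fixed (scaleInverse-inverse X g) (scale-cᶻ X g)
    (∂-asc g (group∞ w) (¬shorterʳ (elem w) g λ pg → contradiction pg out))

  cᵗ : ℕ → 𝓡
  cᵗ i = var (t i) - var (t (suc i))

  actᵗ-𝔉 : ∀ i pg w → subst (swapᵗ i) (𝔉ₙ w) ≈ actˡ (s i) pg (cᵗ i) 𝔉ₙ w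
  actᵗ-𝔉 i pg w with ℓ (gen X (s i) ∘ fun w) ℕ.<? ℓ (fun w)
  ... | yes lt = quotient⇒act (scaleInverse-inverse X (s i)) (scale-cᵗ X i)
          (δ-desc (s i) (group∞ w) (group∞ (mulˡ (s i) pg w)) (λ _ → refl)
            (length<⇒shorter (elem (mulˡ (s i) pg w)) (elem w) lt))
  ... | no ≮ = quotient-0⇒fixed (scaleInverse-inverse X (s i)) (scale-cᵗ X i)
          (δ-asc (s i) (group∞ w) (¬shorterˡ (elem w) (s i) λ _ → ℕ.≮⇒≥ ≮))

  actᵗ-outside : ∀ i → ¬ suc i < n → ∀ w → subst (swapᵗ i) (𝔉ₙ w) ≈ 𝔉ₙ w
  actᵗ-outside i out w = quotient-0⇒fixed (scaleInverse-inverse X (s i)) (scale-cᵗ X i)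
    (δ-asc (s i) (group∞ w) (¬shorterˡ (elem w) (s i) λ pg → contradiction pg out))

  E : (ζ τ : ℕ → R) → List R → 𝔽 → R
  E ζ τ xs w = eval ζ τ xs (𝔉ₙ w)

  E-cong : ∀ {ζ ζ′ τ τ′ xs} → (∀ i → ζ i ≈ ζ′ i) → (∀ i → τ i ≈ τ′ i) → ∀ w → E ζ τ xs w ≈ E ζ′ τ′ xs w
  E-cong e e′ w = eval-local (𝔉ₙ w) ℕ.≤-refl (λ {i} _ → e i) (λ {i} _ → e′ i)

  eval-actᶻ : ∀ g pg {ζ τ xs} w →
    eval ζ τ xs (actᶻ X g (𝔉ₙ w)) ≈ actʳ g pg (eval ζ τ xs (cᶻ X g)) (E ζ τ xs) w
  eval-actᶻ g pg {ζ} {τ} {xs} w =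
    ≈-trans (subst-resp-≈ (point ζ τ xs) (actᶻ-𝔉 g pg w)) (≡⇒≈ (subst-actʳ (point ζ τ xs) w))

  E-swapᶻ : ∀ {i} (pg : suc i < n) {ζ τ xs} w →
    E (ζ ∘ swap i) τ xs w ≈ actʳ (s i) pg (ζ (suc i) - ζ i) (E ζ τ xs) w
  E-swapᶻ {i} pg w = ≈-trans (≈-sym (eval-swapᶻ i (𝔉ₙ w))) (eval-actᶻ (s i) pg w)

  E-swapᵗ : ∀ {i} (pg : suc i < n) {ζ τ xs} w →
    E ζ (τ ∘ swap i) xs w ≈ actˡ (s i) pg (τ i - τ (suc i)) (E ζ τ xs) w
  E-swapᵗ {i} pg {ζ} {τ} {xs} w = ≈-trans (≈-sym (eval-swapᵗ i (𝔉ₙ w)))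
    (≈-trans (subst-resp-≈ (point ζ τ xs) (actᵗ-𝔉 i pg w)) (≡⇒≈ (subst-actˡ (point ζ τ xs) w)))

  insert-upᶻ : ∀ {i} (pg : suc i < n) {a ζ τ xs} w →
    E (insert (suc i) a ζ) τ xs w ≈ actʳ (s i) pg (ζ i - a) (E (insert i a ζ) τ xs) w
  insert-upᶻ {i} pg {a} {ζ} w = ≈-trans
    (E-cong (λ j → ≡⇒≈ (sym (insert-swap a i ζ j))) (λ _ → ≈-refl) w)
    (≈-trans (E-swapᶻ pg w)
      (actʳ-cong (≡⇒≈ (cong₂ _-_ (insert-next a i ζ) (insert-at a i ζ))) (λ _ → ≈-refl) w))

  insert-downᶻ : ∀ {i} (pg : suc i < n) {a ζ τ xs} w →
    E (insert i a ζ) τ xs w ≈ actʳ (s i) pg (a - ζ i) (E (insert (suc i) a ζ) τ xs) w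
  insert-downᶻ {i} pg {a} {ζ} w = ≈-trans
    (E-cong (λ j → ≡⇒≈ (trans (cong (insert i a ζ) (sym (swap-involutive i j))) (insert-swap a i ζ (swap i j))))
      (λ _ → ≈-refl) w)
    (≈-trans (E-swapᶻ pg w)
      (actʳ-cong (≡⇒≈ (cong₂ _-_ (insert-at a (suc i) ζ)
        (trans (sym (insert-swap a i ζ i)) (trans (cong (insert i a ζ) (swap-left i)) (insert-next a i ζ)))))
      (λ _ → ≈-refl) w))

  insert-upᵗ : ∀ {i} (pg : suc i < n) {a ζ τ xs} w →
    E ζ (insert (suc i) a τ) xs w ≈ actˡ (s i) pg (a - τ i) (E ζ (insert i a τ) xs) w
  insert-upᵗ {i} pg {a} {τ = τ} w = ≈-trans
    (E-cong (λ _ → ≈-refl) (λ j → ≡⇒≈ (sym (insert-swap a i τ j))) w)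
    (≈-trans (E-swapᵗ pg w)
      (actˡ-cong (≡⇒≈ (cong₂ _-_ (insert-at a i τ) (insert-next a i τ))) (λ _ → ≈-refl) w))

  -- An entry inserted at position ≥ n can be moved beyond the support of 𝔉ₙ w.
  insert-outsideᶻ : ∀ {q a ζ τ xs} → n ≤ suc q → ∀ w → E (insert q a ζ) τ xs w ≈ E ζ τ xs w
  insert-outsideᶻ {q} {a} {ζ} {τ} {xs} n≤q w = ≈-trans (push (support {TruncVar k} (𝔉ₙ w)))
      (eval-local (𝔉ₙ w) (ℕ.m≤m+n _ q) (λ i<N → ≡⇒≈ (insert-below a ζ i<N)) (λ _ → ≈-refl))
    where
    push : ∀ d → E (insert q a ζ) τ xs w ≈ E (insert (d ℕ.+ q) a ζ) τ xs w
    push zero    = ≈-refl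
    push (suc d) = ≈-trans (push d) (≈-trans
      (subst-resp-≈ (point (insert (d ℕ.+ q) a ζ) τ xs)
        (≈-sym (actᶻ-outside (s (d ℕ.+ q)) (ℕ.≤⇒≯ (ℕ.≤-trans n≤q (s≤s (ℕ.m≤n+m q d)))) w)))
      (≈-trans (eval-swapᶻ (d ℕ.+ q) (𝔉ₙ w))
        (E-cong (λ j → ≡⇒≈ (insert-swap a (d ℕ.+ q) ζ j)) (λ _ → ≈-refl) w)))

  insert-outsideᵗ : ∀ {q a ζ τ xs} → n ≤ suc q → ∀ w → E ζ (insert q a τ) xs w ≈ E ζ τ xs w
  insert-outsideᵗ {q} {a} {ζ} {τ} {xs} n≤q w = ≈-trans (push (support {TruncVar k} (𝔉ₙ w)))
      (eval-local (𝔉ₙ w) (ℕ.m≤m+n _ q) (λ _ → ≈-refl) (λ i<N → ≡⇒≈ (insert-below a τ i<N)))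
    where
    push : ∀ d → E ζ (insert q a τ) xs w ≈ E ζ (insert (d ℕ.+ q) a τ) xs w
    push zero    = ≈-refl
    push (suc d) = ≈-trans (push d) (≈-trans
      (subst-resp-≈ (point ζ (insert (d ℕ.+ q) a τ) xs)
        (≈-sym (actᵗ-outside (d ℕ.+ q) (ℕ.≤⇒≯ (ℕ.≤-trans n≤q (s≤s (ℕ.m≤n+m q d)))) w)))
      (≈-trans (eval-swapᵗ (d ℕ.+ q) (𝔉ₙ w))
        (E-cong (λ _ → ≈-refl) (λ j → ≡⇒≈ (insert-swap a (d ℕ.+ q) τ j)) w)))

  -- Cutting `ζ` beyond the support changes nothing; the entries from position n - 1 on are then
  -- removed one at a time, starting with the last, by `insert-outsideᶻ`.
  cut-outside : ∀ {ζ τ xs} w → E ζ τ xs w ≈ E (cut (n ∸ 1) ζ) τ xs w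
  cut-outside {ζ} {τ} {xs} w = ≈-trans
      (eval-local (𝔉ₙ w) (ℕ.m≤m+n _ (n ∸ 1)) (λ i<N → ≡⇒≈ (sym (cut-below ζ i<N))) (λ _ → ≈-refl))
      (pull (support {TruncVar k} (𝔉ₙ w)))
    where
    pull : ∀ d → E (cut (d ℕ.+ (n ∸ 1)) ζ) τ xs w ≈ E (cut (n ∸ 1) ζ) τ xs w
    pull zero    = ≈-refl
    pull (suc d) = ≈-trans (≈-trans
      (E-cong (λ j → ≡⇒≈ (sym (cut-insert (d ℕ.+ (n ∸ 1)) ζ j))) (λ _ → ≈-refl) w)
      (insert-outsideᶻ (ℕ.≤-trans (ℕ.m≤n+m∸n n 1) (s≤s (ℕ.m≤n+m (n ∸ 1) d))) w)) (pull d)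

  0s : ℕ → R
  0s _ = con 0ℚ

  -- Further zeros inserted at positions from n - 1 on have no effect, and they shift the entries of
  -- `τ` out of the support.
  pad-outside : ∀ {ζ τ xs} w → E ζ (pad (n ∸ 1) τ) xs w ≈ E ζ 0s xs w
  pad-outside {ζ} {τ} {xs} w = ≈-trans (push (support {TruncVar k} (𝔉ₙ w)))
      (eval-local (𝔉ₙ w) (ℕ.m≤m+n _ (n ∸ 1)) (λ _ → ≈-refl) (λ i<N → ≡⇒≈ (pad-below τ i<N)))
    where
    push : ∀ d → E ζ (pad (n ∸ 1) τ) xs w ≈ E ζ (pad (d ℕ.+ (n ∸ 1)) τ) xs w
    push zero    = ≈-refl
    push (suc d) = ≈-trans (push d) (≈-sym (≈-trans
      (E-cong (λ _ → ≈-refl) (λ j → ≡⇒≈ (sym (pad-insert (d ℕ.+ (n ∸ 1)) τ j))) w)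
      (insert-outsideᵗ (ℕ.≤-trans (ℕ.m≤n+m∸n n 1) (s≤s (ℕ.m≤n+m (n ∸ 1) d))) w)))

  -- The two bounds say o + m = n - 1, the first position, counted from 0, from which an entry can
  -- be pushed to infinity. Coming down from there past zeros, `a` has coefficient a - 0 at each
  -- step.
  row-down : ∀ o m {a ζ τ xs bs} → o ℕ.+ m < n → n ≤ suc (o ℕ.+ m) → (∀ j → ζ (o ℕ.+ j) ≈ con 0ℚ) →
    bs Represents E ζ τ xs →
    bs ++ map (λ j → box (# (o ℕ.+ j)) a) (downFrom m) Represents E (insert o a ζ) τ xs
  row-down o m {a} {ζ} {τ} {xs} <n n≤ ζ0 r =
    represents-resp (λ w → E-cong (λ j → ≡⇒≈ (cong (λ q → insert q a ζ j) (sym (ℕ.+-identityʳ o)))) (λ _ → ≈-refl) w)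
      (downFrom-snoc (λ j bs → bs Represents E (insert (o ℕ.+ j) a ζ) τ xs)
        (λ j → box (# (o ℕ.+ j)) a) m step (represents-resp (insert-outsideᶻ n≤) r))
    where
    step : ∀ {j} → j < m → ∀ {bs} → bs Represents E (insert (o ℕ.+ suc j) a ζ) τ xs →
           bs ++ [ box (# (o ℕ.+ j)) a ] Represents E (insert (o ℕ.+ j) a ζ) τ xs
    step {j} j<m {bs} r = represents-resp
        (λ w → ≈-trans (insert-downᶻ pg w) (actʳ-cong coeff
          (E-cong (λ i → ≡⇒≈ (cong (λ q → insert q a ζ i) (sym (ℕ.+-suc o j)))) (λ _ → ≈-refl)) w))
        (represents-snoc (cross-splits (o ℕ.+ j) a) pg r)
      where
      pg : suc (o ℕ.+ j) < n
      pg = ℕ.≤-<-trans (ℕ.≤-trans (ℕ.≤-reflexive (sym (ℕ.+-suc o j))) (ℕ.+-monoʳ-≤ o j<m)) <n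
      coeff : a - ζ (o ℕ.+ j) ≈ a
      coeff = ≈-trans (+-cong ≈-refl (≈-trans (-‿cong (ζ0 j)) -0#≈0#)) (+-identityʳ a)

  -- Going up past zeros, -a has coefficient 0 - (-a) = a. The sign change in the middle of a
  -- Γ-block is thus what gives its column the same variable as its row.
  row-up : ∀ o m {a τ xs bs} → o ℕ.+ m < n → n ≤ suc (o ℕ.+ m) →
    bs Represents E (insert o (- a) 0s) τ xs →
    bs ++ map (λ j → box (# (o ℕ.+ j)) a) (upTo m) Represents E 0s τ xs
  row-up o m {a} {τ} {xs} <n n≤ r =
    represents-resp (λ w → ≈-sym (insert-outsideᶻ n≤ w))
      (upTo-snoc (λ j bs → bs Represents E (insert (o ℕ.+ j) (- a) 0s) τ xs)
        (λ j → box (# (o ℕ.+ j)) a) m step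
        (represents-resp (E-cong (λ j → ≡⇒≈ (cong (λ q → insert q (- a) 0s j) (ℕ.+-identityʳ o))) (λ _ → ≈-refl)) r))
    where
    step : ∀ {j} → j < m → ∀ {bs} → bs Represents E (insert (o ℕ.+ j) (- a) 0s) τ xs →
           bs ++ [ box (# (o ℕ.+ j)) a ] Represents E (insert (o ℕ.+ suc j) (- a) 0s) τ xs
    step {j} j<m {bs} r = represents-resp
        (λ w → ≈-trans (E-cong (λ i → ≡⇒≈ (cong (λ q → insert q (- a) 0s i) (ℕ.+-suc o j))) (λ _ → ≈-refl) w)
          (≈-trans (insert-upᶻ pg w) (actʳ-cong (≈-trans (+-idˡ _) (-‿involutive a)) (λ _ → ≈-refl) w)))
        (represents-snoc (cross-splits (o ℕ.+ j) a) pg r)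
      where
      pg : suc (o ℕ.+ j) < n
      pg = ℕ.≤-<-trans (ℕ.≤-trans (ℕ.≤-reflexive (sym (ℕ.+-suc o j))) (ℕ.+-monoʳ-≤ o j<m)) <n

  private
    row-length : ∀ {i} → i < n ∸ 1 → i ℕ.+ (n ∸ suc i) < n × n ≤ suc (i ℕ.+ (n ∸ suc i))
    row-length {i} i<n-1 = ℕ.≤-reflexive eq , ℕ.≤-reflexive (sym eq)
      where
      eq : suc i ℕ.+ (n ∸ suc i) ≡ n
      eq = ℕ.m+[n∸m]≡n (ℕ.≤-trans i<n-1 (ℕ.m∸n≤m n 1))

  -- Row `i` brings ζ_i down from position n - 1 to position `i`. All entries it passes are zeros of
  -- `cut i ζ`, and those already placed below `i` are not disturbed.
  lower : ∀ {ζ τ xs bs} → bs Represents E 0s τ xs →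
    bs ++ staircase n (λ i j → ζ i) Represents E ζ τ xs
  lower {ζ} {τ} {xs} r = represents-resp cut-outside
    (concatMap-snoc (λ i bs → bs Represents E (cut i ζ) τ xs) _ (n ∸ 1)
      (λ {i} i<n-1 r → represents-resp (E-cong (λ j → ≡⇒≈ (sym (cut-insert i ζ j))) (λ _ → ≈-refl))
        (row-down i (n ∸ suc i) (proj₁ (row-length i<n-1)) (proj₂ (row-length i<n-1))
          (λ j → ≡⇒≈ (cut-above i j ζ)) r))
      (represents-resp (E-cong (λ _ → ≈-refl) (λ _ → ≈-refl)) r))

  -- A zero at position `i` travels up through τ_0, τ_1, ... with coefficients 0 - τ_j and leaves at
  -- position n - 1. The t-variables act from the left, so boxes and rows are prepended, the last
  -- row first.
  upper : ∀ {ζ τ xs bs} → bs Represents E ζ 0s xs →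
    staircase n (λ i j → - τ j) ++ bs Represents E ζ τ xs
  upper {ζ} {τ} {xs} r =
    concatMap-cons (λ i bs → bs Represents E ζ (pad i τ) xs) _ (n ∸ 1) rows
      (represents-resp pad-outside r)
    where
    rows : ∀ {i} → i < n ∸ 1 → ∀ {bs} → bs Represents E ζ (pad (suc i) τ) xs →
      map (λ j → box (# (i ℕ.+ j)) (- τ j)) (downFrom (n ∸ suc i)) ++ bs Represents E ζ (pad i τ) xs
    rows {i} i<n-1 r = represents-resp (λ w → ≈-sym (insert-outsideᵗ (proj₂ (row-length i<n-1)) w))
      (downFrom-cons (λ j bs → bs Represents E ζ (insert (i ℕ.+ j) (con 0ℚ) (pad i τ)) xs)
        (λ j → box (# (i ℕ.+ j)) (- τ j)) (n ∸ suc i) step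
        (represents-resp (E-cong (λ _ → ≈-refl) λ j → ≡⇒≈
          (trans (cong (λ q → insert q (con 0ℚ) (pad i τ) j) (ℕ.+-identityʳ i)) (pad-insert i τ j))) r))
      where
      step : ∀ {j} → j < n ∸ suc i → ∀ {bs} → bs Represents E ζ (insert (i ℕ.+ j) (con 0ℚ) (pad i τ)) xs →
             box (# (i ℕ.+ j)) (- τ j) ∷ bs Represents E ζ (insert (i ℕ.+ suc j) (con 0ℚ) (pad i τ)) xs
      step {j} j<m r = represents-resp
          (λ w → ≈-trans (E-cong (λ _ → ≈-refl)
              (λ l → ≡⇒≈ (cong (λ q → insert q (con 0ℚ) (pad i τ) l) (ℕ.+-suc i j))) w)
            (≈-trans (insert-upᵗ pg w)
              (actˡ-cong (≈-trans (+-idˡ _) (≡⇒≈ (cong -_ (pad-above i j τ)))) (λ _ → ≈-refl) w)))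
          (represents-cons (cross-splits (i ℕ.+ j) (- τ j)) pg r)
        where
        pg : suc (i ℕ.+ j) < n
        pg = ℕ.≤-<-trans (ℕ.≤-trans (ℕ.≤-reflexive (sym (ℕ.+-suc i j))) (ℕ.+-monoʳ-≤ i j<m))
               (proj₁ (row-length i<n-1))

  origin : [] Represents E 0s 0s []
  origin = represents λ w → case {w} (red? [] (elem w))
    where
    all0 : ∀ v → point 0s 0s [] v ≈ con 0ℚ
    all0 (z i) = ≈-refl
    all0 (t i) = ≈-refl
    all0 (p j) = ≈-refl
    case : ∀ {w} (d : Dec (Red [] (fun w))) → 𝟙 (does d) ≈ E 0s 0s [] w
    case {w} (yes R) = ≈-sym (subst-resp-≈ (point 0s 0s []) {g = con 1ℚ}
      (identity (group∞ w) λ a → sym (IsReducedWord.product R a)))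
    case {w} (no ¬R) = ≈-sym (≈-trans (subst-0 _ all0 (𝔉ₙ w))
      (≡⇒≈ (cong con (constant (group∞ w) λ eq → ¬R (length⇒reduced (elem w) []
        (λ a → sym (eq a)) (sym (trans (inv-cong X n eq) (inv-id X n))))))))

-- The Γ-blocks of the three types

Γ-indices-C : ∀ n → Γ-indices C (suc n) ≡ map #_ (downFrom n) ++ 0′ ∷ 0′ ∷ map #_ (upTo n)
Γ-indices-C n = begin
  Γ-indices C (suc n)
    ≡⟨ cong₂ _++_ (List.map-downFrom _ (suc n)) (List.map-upTo _ (suc n)) ⟩
  applyDownFrom _ (suc n) ++ 0′ ∷ applyUpTo #_ n
    ≡⟨ cong (_++ 0′ ∷ applyUpTo #_ n) (List.applyDownFrom-∷ʳ _ n) ⟨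
  (applyDownFrom #_ n ∷ʳ 0′) ++ 0′ ∷ applyUpTo #_ n
    ≡⟨ List.++-assoc (applyDownFrom #_ n) [ 0′ ] _ ⟩
  applyDownFrom #_ n ++ 0′ ∷ 0′ ∷ applyUpTo #_ n
    ≡⟨ cong₂ (λ is js → is ++ 0′ ∷ 0′ ∷ js) (List.map-downFrom #_ n) (List.map-upTo #_ n) ⟨
  map #_ (downFrom n) ++ 0′ ∷ 0′ ∷ map #_ (upTo n) ∎
  where open ≡-Reasoning

map-block : ∀ {A I : Set} (g : I → A) (ι : ℕ → I) {bs : List A} as js cs →
  bs ++ map g (map ι as ++ js ++ map ι cs) ≡ ((bs ++ map (g ∘ ι) as) ++ map g js) ++ map (g ∘ ι) cs
map-block g ι {bs} as js cs = begin
  bs ++ map g (map ι as ++ js ++ map ι cs)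
    ≡⟨ cong (bs ++_) (trans (List.map-++ g (map ι as) _) (cong (map g (map ι as) ++_) (List.map-++ g js _))) ⟩
  bs ++ map g (map ι as) ++ map g js ++ map g (map ι cs)
    ≡⟨ cong₂ (λ us vs → bs ++ us ++ map g js ++ vs) (List.map-∘ as) (List.map-∘ cs) ⟨
  bs ++ map (g ∘ ι) as ++ map g js ++ map (g ∘ ι) cs
    ≡⟨ List.++-assoc bs _ _ ⟨
  (bs ++ map (g ∘ ι) as) ++ map g js ++ map (g ∘ ι) cs
    ≡⟨ List.++-assoc (bs ++ map (g ∘ ι) as) _ _ ⟨
  ((bs ++ map (g ∘ ι) as) ++ map g js) ++ map (g ∘ ι) cs ∎
  where open ≡-Reasoning

GammaStep : ∀ X n m≤n 𝔉 → IsDoubleSchubert X 𝔉 → ℕ → Set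
GammaStep X n m≤n 𝔉 isDS k = ∀ {bs xs} y →
    bs Represents E 0s 0s xs →
    bs ++ map (λ ι → box ι y) (Γ-indices X n) Represents E 0s 0s (y ∷ xs)
  where open Evaluation X n m≤n 𝔉 isDS k

Γ-B : ∀ {n} m≤n 𝔉 isDS k → GammaStep B n m≤n 𝔉 isDS k
Γ-B {suc n} m≤n 𝔉 isDS k y r = ≡.subst (_Represents _)
    (sym (map-block (λ ι → box ι y) #_ (downFrom n) [ 0′ ] (upTo n)))
  (row-up 0 n ℕ.≤-refl ℕ.≤-refl
    (represents-resp (λ w → ≈-trans (≈-sym (eval-s₀ᶻ y (𝔉ₙ w))) (eval-actᶻ s̃ tt w))
      (represents-snoc (faucet-splits y) tt
        (row-down 0 n ℕ.≤-refl ℕ.≤-refl (λ _ → ≈-refl) r))))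
  where open Evaluation B (suc n) m≤n 𝔉 isDS k

-- The coefficient of s₀ is 2y here, and 1 + 2y u_0 is the square of 1 + y u_0. Hence two boxes of
-- index 0, adjacent in reading order at the turn from the row into the column.
Γ-C : ∀ {n} m≤n 𝔉 isDS k → GammaStep C n m≤n 𝔉 isDS k
Γ-C {suc n} m≤n 𝔉 isDS k {bs} {xs} y r = ≡.subst (_Represents E 0s 0s (y ∷ xs))
    (trans (cong (_++ map _ (upTo n)) (List.++-assoc (bs ++ _) [ box 0′ y ] [ box 0′ y ]))
      (trans (sym (map-block (λ ι → box ι y) #_ (downFrom n) (0′ ∷ 0′ ∷ []) (upTo n)))
        (cong (λ is → bs ++ map (λ ι → box ι y) is) (sym (Γ-indices-C n)))))
  (row-up 0 n ℕ.≤-refl ℕ.≤-refl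
    (represents-resp (λ w → ≈-trans (≈-sym (eval-s₀ᶻ y (𝔉ₙ w))) (≈-trans (eval-actᶻ s̃ tt w)
        (≈-trans (actʳ-cong 2y (λ _ → ≈-refl) w) (≈-sym (actʳ-double y (E (insert 0 y 0s) 0s xs) w)))))
      (represents-snoc (faucet-splits y) tt (represents-snoc (faucet-splits y) tt
        (row-down 0 n ℕ.≤-refl ℕ.≤-refl (λ _ → ≈-refl) r)))))
  where
  open Evaluation C (suc n) m≤n 𝔉 isDS k
  2y : 2# * y ≈ y + y
  2y = ≈-trans (*-cong (con-+ 1ℚ 1ℚ) ≈-refl) (≈-trans (distribʳ _ _ _) (+-cong (*-idˡ y) (*-idˡ y)))

-- The row brings y down to position 1, s₁ takes it to position 0 with coefficient y - 0, and s_1̂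
-- follows with coefficient y + 0. These last two factors make up the corner. Since -y reappears at
-- position 1, the column does not pass through s₁ again.
Γ-D : ∀ {n} m≤n 𝔉 isDS k → GammaStep D n m≤n 𝔉 isDS k
Γ-D {suc zero} (s≤s ())
Γ-D {suc (suc n)} m≤n 𝔉 isDS k {bs} {xs} y r = ≡.subst (_Represents E 0s 0s (y ∷ xs))
    (sym (map-block (λ ι → box ι y) (#_ ∘ suc) (downFrom n) [ 1′ ] (upTo n)))
  (row-up 1 n ℕ.≤-refl ℕ.≤-refl (represents-1′
    (≡.subst (_Represents E (insert 1 (- y) 0s) 0s (y ∷ xs)) (List.++-assoc _ [ box (# 0) y ] [ box 0′ y ])
      (represents-resp (λ w → ≈-trans (≈-sym (eval-s₁̂ᶻ y (𝔉ₙ w) ≈-refl)) (≈-trans (eval-actᶻ s̃ tt w)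
          (actʳ-cong (Ring.+-identityʳ (TruncVar k) y) (λ _ → ≈-refl) w)))
        (represents-snoc (faucet-splits y) tt
          (represents-resp (λ w → ≈-trans (insert-downᶻ 1<n w) (actʳ-cong y-0 (λ _ → ≈-refl) w))
            (represents-snoc (cross-splits 0 y) 1<n
              (row-down 1 n ℕ.≤-refl ℕ.≤-refl (λ _ → ≈-refl) r))))))))
  where
  open Evaluation D (suc (suc n)) m≤n 𝔉 isDS k
  open Ring (TruncVar k)
  1<n : 1 < suc (suc n)
  1<n = s≤s (s≤s z≤n)
  y-0 : y - con 0ℚ ≈ y
  y-0 = ≈-trans (+-cong ≈-refl -0#≈0#) (+-identityʳ y)

Γ-block : ∀ X {n} m≤n 𝔉 isDS k → GammaStep X n m≤n 𝔉 isDS k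
Γ-block B = Γ-B
Γ-block C = Γ-C
Γ-block D = Γ-D

-- Each block prepends its variable, so the list comes out reversed. The base reads the blocks from
-- k down to 1, which puts x_1, ..., x_k back in order.
Γ-blocks : ∀ X {n} m≤n 𝔉 isDS k → let open Evaluation X n m≤n 𝔉 isDS k in
  ∀ {bs xs} ys → bs Represents E 0s 0s xs →
  bs ++ concatMap (λ y → map (λ ι → box ι y) (Γ-indices X n)) ys Represents E 0s 0s (ys ʳ++ xs)
Γ-blocks X m≤n 𝔉 isDS k {bs} [] r =
  ≡.subst (λ bs → Evaluation._Represents_ X _ m≤n 𝔉 isDS k bs _) (sym (List.++-identityʳ bs)) r
Γ-blocks X m≤n 𝔉 isDS k {bs} (y ∷ ys) r =
  ≡.subst (λ bs → Evaluation._Represents_ X _ m≤n 𝔉 isDS k bs _) (List.++-assoc bs _ _)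
    (Γ-blocks X m≤n 𝔉 isDS k ys (Γ-block X m≤n 𝔉 isDS k y r))

-- The list of all fillings and the final count

tiles-unique : ∀ ι → Unique (tiles ι)
tiles-unique 0′    = ((λ ()) ∷ []) ∷ [] ∷ []
tiles-unique 1′    = ((λ ()) ∷ (λ ()) ∷ (λ ()) ∷ []) ∷ ((λ ()) ∷ (λ ()) ∷ []) ∷ ((λ ()) ∷ []) ∷ [] ∷ []
tiles-unique (# i) = ((λ ()) ∷ []) ∷ [] ∷ []

∈-tiles : ∀ {ι} (a : Tile ι) → a ∈ tiles ι
∈-tiles {0′}  elbow    = here refl
∈-tiles {1′}  elbow    = here refl
∈-tiles {# i} elbow    = here refl
∈-tiles elbowFaucet    = there (here refl)
∈-tiles cross′         = there (here refl)
∈-tiles crossFaucet    = there (there (here refl))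
∈-tiles elbowFaucets   = there (there (there (here refl)))
∈-tiles cross          = there (here refl)

module _ {k : ℕ} where
  open Ring (TruncVar k)

  fillings : (bs : List (Box k)) → List (Filling bs)
  fillings []       = [ [] ]
  fillings (b ∷ bs) = cartesianProductWith _∷_ (tiles (Box.index b)) (fillings bs)

  fillings-unique : ∀ bs → Unique (fillings bs)
  fillings-unique []       = [] ∷ []
  fillings-unique (b ∷ bs) = Unique.cartesianProductWith⁺ _∷_ (λ { refl → refl , refl })
    (tiles-unique (Box.index b)) (fillings-unique bs)

  ∈-fillings : ∀ {bs} (T : Filling bs) → T ∈ fillings bs
  ∈-fillings []      = here refl
  ∈-fillings (a ∷ T) = ∈-cartesianProductWith⁺ _∷_ (∈-tiles a) (∈-fillings T)

  ∑-cartesian : ∀ {A B C : Set} (h : A → B → C) as bs {f : C → Poly (TruncVar k)} →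
    ∑ (cartesianProductWith h as bs) f ≈ ∑ as λ a → ∑ bs λ b → f (h a b)
  ∑-cartesian h []       bs = ≈-refl
  ∑-cartesian h (a ∷ as) bs = ≈-trans (∑-++ (map (h a) bs))
    (+-cong (≡⇒≈ (∑-map (h a) bs)) (∑-cartesian h as bs))

  ∑-fillings : ∀ bs F → ∑ (fillings bs) (λ T → monomial T * F (word T)) ≈ tileSum bs F
  ∑-fillings []       F = ≈-trans (+-identityʳ _) (*-idˡ _)
  ∑-fillings (b ∷ bs) F = ≈-trans (∑-cartesian _∷_ (tiles (Box.index b)) (fillings bs))
    (∑-cong (tiles (Box.index b)) λ a → ≈-trans
      (∑-cong (fillings bs) λ T → *-assoc _ _ _)
      (≈-trans (∑-distribˡ (fillings bs) _) (*-cong ≈-refl (∑-fillings bs λ u → F (letters a ++ u)))))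

  ∑-filter : ∀ {A : Set} {Q : Pred A 0ℓ} (Q? : Decidable Q) as {f : A → Poly (TruncVar k)} →
    ∑ (filter Q? as) f ≈ ∑ as λ a → f a * (if does (Q? a) then con 1ℚ else con 0ℚ)
  ∑-filter Q? []       = ≈-refl
  ∑-filter Q? (a ∷ as) with does (Q? a)
  ... | true  = +-cong (≈-sym (*-identityʳ _)) (∑-filter Q? as)
  ... | false = ≈-trans (∑-filter Q? as) (≈-trans (≈-sym (+-idˡ _)) (+-cong (≈-sym (zeroʳ _)) ≈-refl))

corollary3p18 : (X : LieType) (n k : ℕ) → minRank X ≤ n →
    (𝔉 : Group∞ X → 𝓡) → IsDoubleSchubert X 𝔉 →
    (w : Group∞ X) → InGroup X n (signedPerm w) →
    Σ[ Ts ∈ List (PipeDream X n k) ]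
    (Enumerates Ts (DPD X n k w) × truncate k (𝔉 w) ≈ ∑ Ts monomial)
corollary3p18 X n k m≤n 𝔉 isDS w w∈ = filter dpd? (fillings bs) ,
    (Unique.filter⁺ dpd? (fillings-unique bs) ,
     λ T → mk⇔ (proj₂ ∘ ∈-filter⁻ dpd? {xs = fillings bs}) (∈-filter⁺ dpd? (∈-fillings T))) ,
    (begin
      truncate k (𝔉 w)                                       ≈⟨ subst-cong truncation (𝔉 w) ⟩
      E (var ∘ z) (var ∘ t) (map (var ∘ x) (allFin k)) v     ≈⟨ tileSum≈ represented v ⟨
      tileSum bs (χ v)                                       ≈⟨ ∑-fillings bs (χ v) ⟨
      ∑ (fillings bs) (λ T → monomial T * χ v (word T))      ≈⟨ ∑-filter dpd? (fillings bs) ⟨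
      ∑ (filter dpd? (fillings bs)) monomial                 ∎)
  where
  open Evaluation X n m≤n 𝔉 isDS k
  open Ring (TruncVar k)
  bs = base X n k
  v : 𝔽
  v = w ∈𝔽 w∈
  dpd? : Decidable (DPD X n k w)
  dpd? T = red? (word T) (elem v)
  truncation : ∀ u → _ ≈ point (var ∘ z) (var ∘ t) (map (var ∘ x) (allFin k)) u
  truncation (z i) = ≈-refl
  truncation (t i) = ≈-refl
  truncation (p j) = ≡⇒≈ (sym (∑-map (var ∘ x) (allFin k)))
  Γs : List (Box k)
  Γs = concatMap (λ m → map (λ ι → box ι (var (x m))) (Γ-indices X n)) (reverse (allFin k))
  reversed : map (var ∘ x) (reverse (allFin k)) ʳ++ [] ≡ map (var ∘ x) (allFin k)
  reversed = trans (cong reverse (List.reverse-map (var ∘ x) (allFin k)))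
                   (List.reverse-involutive (map (var ∘ x) (allFin k)))
  Γs-represented : Γs Represents E 0s 0s (map (var ∘ x) (allFin k))
  Γs-represented = ≡.subst₂ _Represents_ (cong concat (sym (List.map-∘ (reverse (allFin k)))))
    (cong (E 0s 0s) reversed)
    (Γ-blocks X m≤n 𝔉 isDS k (map (var ∘ x) (reverse (allFin k))) origin)
  represented : bs Represents E (var ∘ z) (var ∘ t) (map (var ∘ x) (allFin k))
  -- The upper staircase is read first but acts from the left, so it can be added last, in front of
  -- the Γ-blocks and the lower staircase.
  represented = upper (lower Γs-represented)
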